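{- Let $M$ be a term of the language $\mathbf{PCF}^{\mathbf{list}}$ such that $x_1:\mathtt{bit},\ldots,x_n:\mathtt{bit}\vdash M:\mathtt{bit}^m$ is derivable. Suppose that $$\mathit{EmptyAM}(M)\;\to_{am}^*\;(\langle p_{i_1},\ldots,p_{i_k}\rangle,\ (I,C),\ L),$$ where $p_{i_1},\ldots,p_{i_k}$ are variables. Then $k=m$, and for every family of booleans $\vec u=(b_i)_{i\in I}$ (where $I=\{1,\ldots,n\}$) and all booleans $c_1,\ldots,c_m$: the term $T(\langle p_{i_1},\ldots,p_{i_k}\rangle,(I,C),L)(\vec u)$ is equal to $\langle c_1,\ldots,c_m\rangle$ if and only if the term $\mathtt{let}\ \langle x_1,\ldots,x_n\rangle=\langle b_1,\ldots,b_n\rangle\ \mathtt{in}\ M$ reduces (in zero or more steps of the small-step relation $\to$) to $\langle c_1,\ldots,c_m\rangle$.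
   Context: **Language $\mathbf{PCF}^{\mathbf{list}}$.** Terms: $M,N,P::= x \mid \lambda x.M \mid MN \mid \langle M,N\rangle \mid \pi_1(M)\mid\pi_2(M)\mid \mathtt{skip}\mid \mathtt{let}\ \mathtt{skip}=M\ \mathtt{in}\ N \mid \mathtt{tt}\mid\mathtt{ff}\mid \mathtt{if}\ M\ \mathtt{then}\ N\ \mathtt{else}\ P \mid \mathtt{and}\mid\mathtt{xor}\mid\mathtt{not}\mid \mathtt{inj}_1(M)\mid\mathtt{inj}_2(M)\mid \mathtt{match}\ P\ \mathtt{with}\ (x\mapsto M\mid y\mapsto N)\mid \mathtt{split}\mid Y(M)\mid \mathtt{Err}$. Types: $A,B::=\mathtt{bit}\mid A\oplus B\mid A\times B\mid \mathbf 1\mid A\to B\mid [A]$. Typing rules (context $\Delta$): $\Delta,x:A\vdash x:A$; $\mathtt{tt},\mathtt{ff}:\mathtt{bit}$; $\mathtt{skip}:\mathbf 1$; $\mathtt{Err}:A$ for any $A$; $\mathtt{not}:\mathtt{bit}\to\mathtt{bit}$; $\mathtt{and},\mathtt{xor}:\mathtt{bit}\times\mathtt{bit}\to\mathtt{bit}$; $\mathtt{split}:[A]\to\mathbf 1\oplus(A\times[A])$; the usual rules for $\lambda$, application, pairs, projections, injections, $\mathtt{let}\ \mathtt{skip}$ (first argument of type $\mathbf 1$), and $\mathtt{match}$ (on $P:A\oplus B$, branches typed with $x:A$ resp. $y:B$); if $\Delta\vdash M:\mathbf 1\oplus(A\times[A])$ then $\Delta\vdash M:[A]$; if $\Delta\vdash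 M:A\to A$ then $\Delta\vdash Y(M):A$; $\mathtt{if}\ P\ \mathtt{then}\ M\ \mathtt{else}\ N : C$ when $P:\mathtt{bit}$, $M,N:C$ and $C$ is first-order, i.e. generated by $C::=\mathtt{bit}\mid C\times C\mid [C]$. Notation: $\mathtt{nil}=\mathtt{inj}_1(\mathtt{skip})$, $M::N=\mathtt{inj}_2\langle M,N\rangle$, $[M_1,\ldots,M_n]=M_1::(\cdots::(M_n::\mathtt{nil}))$, $\langle M_1,\ldots,M_n\rangle=\langle M_1,\langle\ldots,M_n\rangle\rangle$ with the corresponding $n$-ary projections $\pi_i$; $\mathtt{bit}^m$ is the $m$-fold (right-nested) product of $\mathtt{bit}$; $\mathtt{let}\ x=N\ \mathtt{in}\ M$ is $(\lambda x.M)N$; $\mathtt{let}\ \langle x_1,\ldots,x_n\rangle=N\ \mathtt{in}\ M$ is $\mathtt{let}\ z=N\ \mathtt{in}\ \mathtt{let}\ x_1=\pi_1(z)\ \mathtt{in}\cdots\mathtt{let}\ x_n=\pi_n(z)\ \mathtt{in}\ M$ with $z$ fresh. **Small-step semantics $\to$:** the smallest relation closed under arbitrary subterm contexts containing $(\lambda x.M)N\to M[N/x]$; $\pi_i\langle M_1,M_2\rangle\to M_i$; $\mathtt{let}\ \mathtt{skip}=\mathtt{skip}\ \mathtt{in}\ M\to M$; $\mathtt{if}\ \mathtt{tt}\ \mathtt{then}\ M\ \mathtt{else}\ N\to M$; $\mathtt{if}\ \mathtt{ff}\ \mathtt{then}\ M\ \mathtt{else}\ N\to N$; $\mathtt{split}\,M\to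 M$; $\mathtt{match}\ \mathtt{inj}_i(P)\ \mathtt{with}\ (x_1\mapsto M_1\mid x_2\mapsto M_2)\to M_i[P/x_i]$; $Y(M)\to M(Y(M))$; and the evident rules computing $\mathtt{not},\mathtt{and},\mathtt{xor}$ on the constants $\mathtt{tt},\mathtt{ff}$ (e.g. $\mathtt{not}\ \mathtt{tt}\to\mathtt{ff}$). $\mathtt{Err}$ does not reduce. **Reversible circuits.** A gate is $\mathrm{cnot}_i(b_1^{j_1}\ldots b_r^{j_r})$ with $i,j_1,\ldots,j_r$ natural numbers, $i\neq j_k$, $b_k$ booleans (written $\mathrm{not}_i$ if $r=0$); its wires are $\{i,j_1,\ldots,j_r\}$; $\mathrm{wires}(C)$ is the union of the wires of the gates of a list $C$. A circuit is $(I,C,O)$ with $C$ a list of gates and $I,O$ sets of wires. Executing gate $\mathrm{cnot}_i(b_1^{j_1}\ldots b_r^{j_r})$ on a valuation $v$ (a boolean per wire) gives $w$ with $w_l=v_l$ for $l\neq i$ and $w_i=v_i\ \mathtt{xor}\ \bigwedge_{k}(v_{j_k}\ \mathtt{xor}\ b_k\ \mathtt{xor}\ \mathtt{tt})$ (and $w_i=\mathtt{not}(v_i)$ if $r=0$). Executing $(I,C,O)$ on inputs $(x_i)_{i\in I}$: initialize $v_k=x_k$ for $k\in I$ and $v_k=\mathtt{ff}$ for all other wires, execute the gates of $C$ in reverse list order, and return $(v_k)_{k\in O}$. **Abstract machines.** A circuit-generating abstract machine is a triple $(M,(I,C),L)$ where $p_1:\mathtt{bit},\ldots,p_{n+k}:\mathtt{bit}\vdash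 M:\mathtt{bit}^m$, $I=\{1,\ldots,n\}$, $C$ is a list of gates, and $L$ is a one-to-one map from the free variables of $M$ onto wires in $\mathrm{wires}(C)\cup I$. For $x_1:\mathtt{bit},\ldots,x_n:\mathtt{bit}\vdash M:\mathtt{bit}^m$, $\mathit{EmptyAM}(M)=(M,(\{1,\ldots,n\},[\,]),\{x_i\mapsto i\})$. A first-order extension of $L$ is a term built from variables of the domain of $L$ by tuples $\langle\ldots\rangle$ and list literals $[\ldots]$; two such have the same shape if both are tuples of the same size or both lists of the same length with componentwise same shape (variables having the same shape). Beta-contexts $E[-]$ are one-hole contexts whose hole may be in any immediate subterm position of any term constructor (under $\lambda$, either side of application, pairs, projections, $\mathtt{let}\ \mathtt{skip}$, any of the three arguments of $\mathtt{if}$, injections, any of the three parts of $\mathtt{match}$, $Y$). The relation $\to_{am}$ is: $(E[R],RC,L)\to_{am}(E[R'],RC,L)$ for each of the rules $(\lambda x.M)N\mapsto M[N/x]$, $\pi_i\langle M_1,M_2\rangle\mapsto M_i$, $\mathtt{let}\ \mathtt{skip}=\mathtt{skip}\ \mathtt{in}\ M\mapsto M$, $\mathtt{split}\,M\mapsto M$, $\mathtt{match}\ \mathtt{inj}_i(P)\ldots\mapsto M_i[P/x_i]$, $Y(M)\mapsto M(Y(M))$; and the boolean rules, where $i_0$ is a new wire, $p_{i_0}$ a fresh variable, $L'=L\cup\{p_{i_0}\mapsto i_0\}$, and $G::(I,C)$ means $(I,G::C)$: $(E[\mathtt{ff}],RC,L)\to_{am}(E[p_{i_0}],RC,L')$;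 $(E[\mathtt{tt}],RC,L)\to_{am}(E[p_{i_0}],\mathrm{not}_{i_0}::RC,L')$; $(E[\mathtt{not}\ p_i],RC,L)\to_{am}(E[p_{i_0}],\mathrm{cnot}_{i_0}(\mathtt{ff}^{L(p_i)})::RC,L')$; $(E[\mathtt{and}\ p_i\ p_j],RC,L)\to_{am}(E[p_{i_0}],\mathrm{cnot}_{i_0}(\mathtt{tt}^{L(p_i)}\mathtt{tt}^{L(p_j)})::RC,L')$; $(E[\mathtt{xor}\ p_i\ p_j],RC,L)\to_{am}(E[p_{i_0}],\mathrm{cnot}_{i_0}(\mathtt{tt}^{L(p_i)})::\mathrm{cnot}_{i_0}(\mathtt{tt}^{L(p_j)})::RC,L')$; and for first-order extensions $V,W$ of $L$: if $V,W$ have the same shape, $(E[\mathtt{if}\ p_i\ \mathtt{then}\ V\ \mathtt{else}\ W],RC,L)\to_{am}(E[U],RC',L'')$ where $U$ has the same shape, its variables $u_1,\ldots,u_r$ are fresh, pairwise distinct and mapped by $L''\supseteq L$ to new distinct wires, and, writing $v_1,\ldots,v_r$ and $w_1,\ldots,w_r$ for the corresponding variables of $V$ and $W$, $RC'$ is $RC$ with the gates $\mathrm{cnot}_{u_j}(\mathtt{tt}^{p_i}\mathtt{tt}^{v_j})$ and $\mathrm{cnot}_{u_j}(\mathtt{ff}^{p_i}\mathtt{tt}^{w_j})$ added (variables standing for their wires); otherwise it steps to $E[\mathtt{Err}]$. **Readback.** For a machine $(M,(I,C),L)$ and $\vec u=(u_i)_{i\in I}$, let $v$ be the final valuation of executing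 the circuit $(I,C,\mathrm{Range}(L))$ on $\vec u$; $T(M,(I,C),L)(\vec u)$ is $M$ with each free variable $x$ replaced by the boolean constant $v_{L(x)}$. -}

module Defs where

open import Data.Bool using (Bool; true; false; if_then_else_; _∧_; not) renaming (_xor_ to _⊻_)
open import Data.Fin using (Fin; zero; suc; toℕ)
open import Data.List as List using (List; []; _∷_; _++_; concatMap; foldr)
open import Data.List.Membership.Propositional using (_∈_; _∉_)
open import Data.List.Relation.Binary.Permutation.Propositional using (_↭_)
open import Data.List.Relation.Binary.Pointwise using (Pointwise)
open import Data.List.Relation.Unary.All using (All; []; _∷_)
open import Data.List.Relation.Unary.Any using (here; there)
open import Data.List.Relation.Unary.Unique.Propositional using (Unique)
open import Data.Maybe using (Maybe; just; nothing; maybe′)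
open import Data.Nat using (ℕ; zero; suc; _≡ᵇ_)
open import Data.Product using (Σ; _×_; _,_; proj₁; proj₂)
open import Data.Vec as Vec using (Vec; []; _∷_; lookup)
open import Function using (_∘_)
open import Relation.Binary.Construct.Closure.ReflexiveTransitive using (Star)
open import Relation.Binary.PropositionalEquality using (refl)
open import Relation.Nullary using (¬_)

Name Wire : Set
Name = ℕ
Wire = ℕ

private variable
  n k l : ℕ

-- Locally nameless syntax: free variables are names (fvar), λ- and
-- match-bound variables are de Bruijn indices (bvar).  A term in the usual
-- sense (up to α-equivalence) is an element of Term 0.

data Term (k : ℕ) : Set where
  bvar    : Fin k → Term k
  fvar    : Name → Term k
  lam     : Term (suc k) → Term k
  app     : Term k → Term k → Term k
  pair    : Term k → Term k → Term k
  π₁ π₂   : Term k → Term k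
  skip    : Term k
  letskip : Term k → Term k → Term k
  tt ff   : Term k
  ite     : Term k → Term k → Term k → Term k
  and xor neg : Term k
  inj₁ inj₂   : Term k → Term k
  match   : Term k → Term (suc k) → Term (suc k) → Term k
  split   : Term k
  Y       : Term k → Term k
  Err     : Term k

bool : Bool → Term k
bool true  = tt
bool false = ff

nil : Term k
nil = inj₁ skip

cons : Term k → Term k → Term k
cons M N = inj₂ (pair M N)

-- The 1-tuple is its component; the empty tuple is skip, of type bit^ 0 = 𝟙.
tuple : Vec (Term k) n → Term k
tuple []           = skip
tuple (M ∷ [])     = M
tuple (M ∷ N ∷ Ms) = pair M (tuple (N ∷ Ms))

-- The n-ary projections π₁ … πₙ of a right-nested n-tuple.
projections : ∀ n → Term k → Vec (Term k) n
projections zero          M = []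
projections (suc zero)    M = M ∷ []
projections (suc (suc n)) M = π₁ M ∷ projections (suc n) (π₂ M)

lift : (Fin k → Fin l) → Fin (suc k) → Fin (suc l)
lift ρ zero    = zero
lift ρ (suc i) = suc (ρ i)

rename : (Fin k → Fin l) → Term k → Term l
rename ρ (bvar i)      = bvar (ρ i)
rename ρ (fvar x)      = fvar x
rename ρ (lam M)       = lam (rename (lift ρ) M)
rename ρ (app M N)     = app (rename ρ M) (rename ρ N)
rename ρ (pair M N)    = pair (rename ρ M) (rename ρ N)
rename ρ (π₁ M)        = π₁ (rename ρ M)
rename ρ (π₂ M)        = π₂ (rename ρ M)
rename ρ skip          = skip
rename ρ (letskip M N) = letskip (rename ρ M) (rename ρ N)
rename ρ tt            = tt
rename ρ ff            = ff
rename ρ (ite P M N)   = ite (rename ρ P) (rename ρ M) (rename ρ N)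
rename ρ and           = and
rename ρ xor           = xor
rename ρ neg           = neg
rename ρ (inj₁ M)      = inj₁ (rename ρ M)
rename ρ (inj₂ M)      = inj₂ (rename ρ M)
rename ρ (match P M N) = match (rename ρ P) (rename (lift ρ) M) (rename (lift ρ) N)
rename ρ split         = split
rename ρ (Y M)         = Y (rename ρ M)
rename ρ Err           = Err

weaken : Term k → Term (suc k)
weaken = rename suc

lifts : (Fin k → Term l) → Fin (suc k) → Term (suc l)
lifts σ zero    = bvar zero
lifts σ (suc i) = weaken (σ i)

-- Simultaneous capture-avoiding substitution for bound indices (σ) and for
-- names (ν).
subst : (σ : Fin k → Term l) (ν : Name → Term l) → Term k → Term l
subst σ ν (bvar i)      = σ i
subst σ ν (fvar x)      = ν x
subst σ ν (lam M)       = lam (subst (lifts σ) (weaken ∘ ν) M)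
subst σ ν (app M N)     = app (subst σ ν M) (subst σ ν N)
subst σ ν (pair M N)    = pair (subst σ ν M) (subst σ ν N)
subst σ ν (π₁ M)        = π₁ (subst σ ν M)
subst σ ν (π₂ M)        = π₂ (subst σ ν M)
subst σ ν skip          = skip
subst σ ν (letskip M N) = letskip (subst σ ν M) (subst σ ν N)
subst σ ν tt            = tt
subst σ ν ff            = ff
subst σ ν (ite P M N)   = ite (subst σ ν P) (subst σ ν M) (subst σ ν N)
subst σ ν and           = and
subst σ ν xor           = xor
subst σ ν neg           = neg
subst σ ν (inj₁ M)      = inj₁ (subst σ ν M)
subst σ ν (inj₂ M)      = inj₂ (subst σ ν M)
subst σ ν (match P M N) =
  match (subst σ ν P) (subst (lifts σ) (weaken ∘ ν) M) (subst (lifts σ) (weaken ∘ ν) N)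
subst σ ν split         = split
subst σ ν (Y M)         = Y (subst σ ν M)
subst σ ν Err           = Err

single : Term k → Fin (suc k) → Term k
single N zero    = N
single N (suc i) = bvar i

-- M [ N ] is M[N/x], where x is the variable with index zero in M.
_[_] : Term (suc k) → Term k → Term k
M [ N ] = subst (single N) fvar M

substNames : (Name → Term k) → Term k → Term k
substNames = subst bvar

-- Turns the free name x into index zero, so that
-- lam (abstractName x M) is λx.M.
abstractName : Name → Term k → Term (suc k)
abstractName x M =
  substNames (λ y → if x ≡ᵇ y then bvar zero else fvar y) (weaken M)

letIn : Name → Term k → Term k → Term k
letIn x N M = app (lam (abstractName x M)) N

letsIn : Vec Name n → Vec (Term k) n → Term k → Term k
letsIn []       []       M = M
letsIn (x ∷ xs) (N ∷ Ns) M = letIn x N (letsIn xs Ns M)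

-- let ⟨x₁,…,xₙ⟩ = N in M.  The fresh z of the definition is the index bound
-- by the outer lam.
letTuple : Vec Name n → Term k → Term k → Term k
letTuple {n} xs N M = app (lam (letsIn xs (projections n (bvar zero)) (weaken M))) N

infixr 7 _⊗_
infixr 6 _⊕_
infixr 5 _⇒_

data Type : Set where
  bit         : Type
  𝟙           : Type
  _⊕_ _⊗_ _⇒_ : Type → Type → Type
  [_]ᵗ        : Type → Type

bit^ : ℕ → Type
bit^ zero          = 𝟙
bit^ (suc zero)    = bit
bit^ (suc (suc m)) = bit ⊗ bit^ (suc m)

data FirstOrder : Type → Set where
  bit  : FirstOrder bit
  _⊗_  : ∀ {A B} → FirstOrder A → FirstOrder B → FirstOrder (A ⊗ B)
  [_]ᵗ : ∀ {A} → FirstOrder A → FirstOrder [ A ]ᵗ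

NameContext : Set
NameContext = List (Name × Type)

bits : Vec Name n → NameContext
bits xs = Vec.toList (Vec.map (_, bit) xs)

infix 4 _∣_⊢_∶_

-- The context is split into Δ, typing the names, and Γ, typing the bound
-- indices.
data _∣_⊢_∶_ (Δ : NameContext) {k} (Γ : Vec Type k) : Term k → Type → Set where
  fvar    : ∀ {x A} → (x , A) ∈ Δ → Δ ∣ Γ ⊢ fvar x ∶ A
  bvar    : ∀ i → Δ ∣ Γ ⊢ bvar i ∶ lookup Γ i
  tt      : Δ ∣ Γ ⊢ tt ∶ bit
  ff      : Δ ∣ Γ ⊢ ff ∶ bit
  skip    : Δ ∣ Γ ⊢ skip ∶ 𝟙
  Err     : ∀ {A} → Δ ∣ Γ ⊢ Err ∶ A
  neg     : Δ ∣ Γ ⊢ neg ∶ bit ⇒ bit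
  and     : Δ ∣ Γ ⊢ and ∶ bit ⊗ bit ⇒ bit
  xor     : Δ ∣ Γ ⊢ xor ∶ bit ⊗ bit ⇒ bit
  split   : ∀ {A} → Δ ∣ Γ ⊢ split ∶ [ A ]ᵗ ⇒ 𝟙 ⊕ (A ⊗ [ A ]ᵗ)
  lam     : ∀ {A B M} → Δ ∣ A ∷ Γ ⊢ M ∶ B → Δ ∣ Γ ⊢ lam M ∶ A ⇒ B
  app     : ∀ {A B M N} → Δ ∣ Γ ⊢ M ∶ A ⇒ B → Δ ∣ Γ ⊢ N ∶ A → Δ ∣ Γ ⊢ app M N ∶ B
  pair    : ∀ {A B M N} → Δ ∣ Γ ⊢ M ∶ A → Δ ∣ Γ ⊢ N ∶ B → Δ ∣ Γ ⊢ pair M N ∶ A ⊗ B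
  π₁      : ∀ {A B M} → Δ ∣ Γ ⊢ M ∶ A ⊗ B → Δ ∣ Γ ⊢ π₁ M ∶ A
  π₂      : ∀ {A B M} → Δ ∣ Γ ⊢ M ∶ A ⊗ B → Δ ∣ Γ ⊢ π₂ M ∶ B
  inj₁    : ∀ {A B M} → Δ ∣ Γ ⊢ M ∶ A → Δ ∣ Γ ⊢ inj₁ M ∶ A ⊕ B
  inj₂    : ∀ {A B M} → Δ ∣ Γ ⊢ M ∶ B → Δ ∣ Γ ⊢ inj₂ M ∶ A ⊕ B
  letskip : ∀ {A M N} → Δ ∣ Γ ⊢ M ∶ 𝟙 → Δ ∣ Γ ⊢ N ∶ A → Δ ∣ Γ ⊢ letskip M N ∶ A
  match   : ∀ {A B C P M N} → Δ ∣ Γ ⊢ P ∶ A ⊕ B →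
            Δ ∣ A ∷ Γ ⊢ M ∶ C → Δ ∣ B ∷ Γ ⊢ N ∶ C → Δ ∣ Γ ⊢ match P M N ∶ C
  fold    : ∀ {A M} → Δ ∣ Γ ⊢ M ∶ 𝟙 ⊕ (A ⊗ [ A ]ᵗ) → Δ ∣ Γ ⊢ M ∶ [ A ]ᵗ
  Y       : ∀ {A M} → Δ ∣ Γ ⊢ M ∶ A ⇒ A → Δ ∣ Γ ⊢ Y M ∶ A
  ite     : ∀ {C P M N} → FirstOrder C → Δ ∣ Γ ⊢ P ∶ bit →
            Δ ∣ Γ ⊢ M ∶ C → Δ ∣ Γ ⊢ N ∶ C → Δ ∣ Γ ⊢ ite P M N ∶ C

-- Context k l: one-hole contexts that are terms over k bound indices and
-- whose hole is in the scope of l bound indices.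
data Context (k : ℕ) : ℕ → Set where
  □        : Context k k
  lam      : Context (suc k) l → Context k l
  appˡ     : Context k l → Term k → Context k l
  appʳ     : Term k → Context k l → Context k l
  pairˡ    : Context k l → Term k → Context k l
  pairʳ    : Term k → Context k l → Context k l
  π₁ π₂    : Context k l → Context k l
  letskipˡ : Context k l → Term k → Context k l
  letskipʳ : Term k → Context k l → Context k l
  iteᶜ     : Context k l → Term k → Term k → Context k l
  iteᵗ     : Term k → Context k l → Term k → Context k l
  iteᵉ     : Term k → Term k → Context k l → Context k l
  inj₁     : Context k l → Context k l
  inj₂     : Context k l → Context k l
  matchᶜ   : Context k l → Term (suc k) → Term (suc k) → Context k l
  matchˡ   : Term k → Context (suc k) l → Term (suc k) → Context k l
  matchʳ   : Term k → Term (suc k) → Context (suc k) l → Context k l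
  Y        : Context k l → Context k l

_⟦_⟧ : Context k l → Term l → Term k
□            ⟦ R ⟧ = R
lam E        ⟦ R ⟧ = lam (E ⟦ R ⟧)
appˡ E N     ⟦ R ⟧ = app (E ⟦ R ⟧) N
appʳ M E     ⟦ R ⟧ = app M (E ⟦ R ⟧)
pairˡ E N    ⟦ R ⟧ = pair (E ⟦ R ⟧) N
pairʳ M E    ⟦ R ⟧ = pair M (E ⟦ R ⟧)
π₁ E         ⟦ R ⟧ = π₁ (E ⟦ R ⟧)
π₂ E         ⟦ R ⟧ = π₂ (E ⟦ R ⟧)
letskipˡ E N ⟦ R ⟧ = letskip (E ⟦ R ⟧) N
letskipʳ M E ⟦ R ⟧ = letskip M (E ⟦ R ⟧)
iteᶜ E M N   ⟦ R ⟧ = ite (E ⟦ R ⟧) M N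
iteᵗ P E N   ⟦ R ⟧ = ite P (E ⟦ R ⟧) N
iteᵉ P M E   ⟦ R ⟧ = ite P M (E ⟦ R ⟧)
inj₁ E       ⟦ R ⟧ = inj₁ (E ⟦ R ⟧)
inj₂ E       ⟦ R ⟧ = inj₂ (E ⟦ R ⟧)
matchᶜ E M N ⟦ R ⟧ = match (E ⟦ R ⟧) M N
matchˡ P E N ⟦ R ⟧ = match P (E ⟦ R ⟧) N
matchʳ P M E ⟦ R ⟧ = match P M (E ⟦ R ⟧)
Y E          ⟦ R ⟧ = Y (E ⟦ R ⟧)

infix 4 _↦_ _↦ᵇ_ _⟶_ _⟶*_

-- The rules shared by the small-step semantics and the abstract machine.
data _↦_ {k} : Term k → Term k → Set where
  β       : ∀ M N → app (lam M) N ↦ M [ N ]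
  π₁      : ∀ M N → π₁ (pair M N) ↦ M
  π₂      : ∀ M N → π₂ (pair M N) ↦ N
  letskip : ∀ M → letskip skip M ↦ M
  split   : ∀ M → app split M ↦ M
  match₁  : ∀ P M N → match (inj₁ P) M N ↦ M [ P ]
  match₂  : ∀ P M N → match (inj₂ P) M N ↦ N [ P ]
  Y       : ∀ M → Y M ↦ app M (Y M)

data _↦ᵇ_ {k} : Term k → Term k → Set where
  if-tt : ∀ M N → ite tt M N ↦ᵇ M
  if-ff : ∀ M N → ite ff M N ↦ᵇ N
  neg   : ∀ b → app neg (bool b) ↦ᵇ bool (not b)
  and   : ∀ a b → app and (pair (bool a) (bool b)) ↦ᵇ bool (a ∧ b)
  xor   : ∀ a b → app xor (pair (bool a) (bool b)) ↦ᵇ bool (a ⊻ b)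

data _⟶_ {k} : Term k → Term k → Set where
  pure    : (E : Context k l) {R R′ : Term l} → R ↦  R′ → E ⟦ R ⟧ ⟶ E ⟦ R′ ⟧
  boolean : (E : Context k l) {R R′ : Term l} → R ↦ᵇ R′ → E ⟦ R ⟧ ⟶ E ⟦ R′ ⟧

_⟶*_ : Term k → Term k → Set
_⟶*_ = Star _⟶_

Control : Set
Control = Bool × Wire

record Gate : Set where
  constructor cnot
  field
    target           : Wire
    controls         : List Control
    .target∉controls : target ∉ List.map proj₂ controls

open Gate public

wires : List Gate → List Wire
wires = concatMap λ G → target G ∷ List.map proj₂ (controls G)

Valuation : Set
Valuation = Wire → Bool

-- For an empty list of controls the conjunction is true, so the target is
-- negated.
execGate : Gate → Valuation → Valuation
execGate G v l =
  if l ≡ᵇ target G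
  then v l ⊻ foldr (λ (b , j) r → ((v j ⊻ b) ⊻ true) ∧ r) true (controls G)
  else v l

initial : Vec Wire n → Vec Bool n → Valuation
initial []      []      l = false
initial (i ∷ I) (b ∷ u) l = if l ≡ᵇ i then b else initial I u l

-- The final valuation of a circuit (I, C, O) on inputs u; O only selects
-- which of its values are returned.  The last gate of the list acts first.
finalValuation : Vec Wire n → List Gate → Vec Bool n → Valuation
finalValuation I C u = foldr execGate (initial I u) C

Binding : Set
Binding = Name × Wire

Linking : Set
Linking = List Binding

domain : Linking → List Name
domain = List.map proj₁

range : Linking → List Wire
range = List.map proj₂

linked : Linking → Name → Maybe Wire
linked []            x = nothing
linked ((y , i) ∷ L) x = if x ≡ᵇ y then just i else linked L x

inputs : ∀ n → Vec Wire n
inputs n = Vec.tabulate (suc ∘ toℕ)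

-- A triple (M, (I, C), L) with I = {1,…,n}.  Typability of M and injectivity
-- of L are not part of the record: transitions are defined on all triples.
record Machine (n : ℕ) : Set where
  constructor machine
  field
    term    : Term 0
    gates   : List Gate
    linking : Linking

EmptyAM : Vec Name n → Term 0 → Machine n
EmptyAM {n} xs M = machine M [] (Vec.toList (Vec.zip xs (inputs n)))

-- p is a fresh variable and i a new wire.  Range L is excluded as well
-- because a wire allocated for ff belongs neither to I nor to wires C.
record Fresh (n : ℕ) (C : List Gate) (L : Linking) (p↦i : Binding) : Set where
  constructor fresh
  field
    p∉L : proj₁ p↦i ∉ domain L
    i∉I : proj₂ p↦i ∉ Vec.toList (inputs n)
    i∉C : proj₂ p↦i ∉ wires C
    i∉L : proj₂ p↦i ∉ range L

LinkedControl : Linking → Set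
LinkedControl L = Bool × Σ Binding (_∈ L)

control : ∀ {L} → LinkedControl L → Control
control (b , (_ , j) , _) = b , j

∈-range : ∀ {L : Linking} {y} → y ∈ L → proj₂ y ∈ range L
∈-range (here refl) = here refl
∈-range (there y∈L) = there (∈-range y∈L)

controls⊆range : ∀ {L} (cs : List (LinkedControl L)) {i} →
                 i ∈ List.map proj₂ (List.map control cs) → i ∈ range L
controls⊆range ((_ , _ , y∈L) ∷ cs) (here refl) = ∈-range y∈L
controls⊆range (_ ∷ cs)             (there i∈)  = controls⊆range cs i∈

-- A gate acting on a new wire and controlled by wires of linked variables.
cnotNew : ∀ {C L u} → Fresh n C L u → List (LinkedControl L) → Gate
cnotNew {u = _ , i} fr cs =
  cnot i (List.map control cs) (λ i∈ → Fresh.i∉L fr (controls⊆range cs i∈))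

-- First-order extensions; n-ary tuples are nested binary ones.
data Tree (A : Set) : Set where
  leaf : A → Tree A
  pair : Tree A → Tree A → Tree A
  list : List (Tree A) → Tree A

data SameShape {A : Set} : Tree A → Tree A → Set where
  leaf : ∀ {x y} → SameShape (leaf x) (leaf y)
  pair : ∀ {V V′ W W′} → SameShape V W → SameShape V′ W′ →
         SameShape (pair V V′) (pair W W′)
  list : ∀ {Vs Ws} → Pointwise SameShape Vs Ws → SameShape (list Vs) (list Ws)

leaves : ∀ {A} → Tree A → List A
leavesᴸ : ∀ {A} → List (Tree A) → List A
leaves (leaf x)   = x ∷ []
leaves (pair V W) = leaves V ++ leaves W
leaves (list Vs)  = leavesᴸ Vs
leavesᴸ []       = []
leavesᴸ (V ∷ Vs) = leaves V ++ leavesᴸ Vs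

-- The leaves carry both a variable and its wire; only the variable appears
-- in the term.
⌜_⌝ : Tree Binding → Term k
⌜_⌝ᴸ : List (Tree Binding) → Term k
⌜ leaf (p , _) ⌝ = fvar p
⌜ pair V W ⌝     = pair ⌜ V ⌝ ⌜ W ⌝
⌜ list Vs ⌝      = ⌜ Vs ⌝ᴸ
⌜ [] ⌝ᴸ     = nil
⌜ V ∷ Vs ⌝ᴸ = cons ⌜ V ⌝ ⌜ Vs ⌝ᴸ

Extension : Linking → Tree Binding → Set
Extension L V = All (_∈ L) (leaves V)

-- For all j, the gates cnot_{uⱼ}(tt^p tt^{vⱼ}) and cnot_{uⱼ}(ff^p tt^{wⱼ}).
-- The lists have equal lengths whenever the trees have the same shape.
ifGates : ∀ {C L p us vs ws} → p ∈ L →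
          All (Fresh n C L) us → All (_∈ L) vs → All (_∈ L) ws → List Gate
ifGates p (u ∷ us) (v ∷ vs) (w ∷ ws) =
  cnotNew u ((true  , _ , p) ∷ (true , _ , v) ∷ []) ∷
  cnotNew u ((false , _ , p) ∷ (true , _ , w) ∷ []) ∷
  ifGates p us vs ws
ifGates p _ _ _ = []

infix 4 _⟶am_ _⟶am*_

data _⟶am_ {n} : Machine n → Machine n → Set where

  pure : ∀ {C L} (E : Context 0 l) {R R′} → R ↦ R′ →
         machine (E ⟦ R ⟧) C L ⟶am machine (E ⟦ R′ ⟧) C L

  ff : ∀ {C L q i₀} (E : Context 0 l) → Fresh n C L (q , i₀) →
       machine (E ⟦ ff ⟧) C L ⟶am machine (E ⟦ fvar q ⟧) C ((q , i₀) ∷ L)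

  tt : ∀ {C L q i₀} (E : Context 0 l) (new : Fresh n C L (q , i₀)) →
       machine (E ⟦ tt ⟧) C L ⟶am
       machine (E ⟦ fvar q ⟧) (cnotNew new [] ∷ C) ((q , i₀) ∷ L)

  neg : ∀ {C L p i q i₀} (E : Context 0 l) (new : Fresh n C L (q , i₀)) →
        (p∈L : (p , i) ∈ L) →
        machine (E ⟦ app neg (fvar p) ⟧) C L ⟶am
        machine (E ⟦ fvar q ⟧)
                (cnotNew new ((false , _ , p∈L) ∷ []) ∷ C)
                ((q , i₀) ∷ L)

  and : ∀ {C L p i p′ i′ q i₀} (E : Context 0 l) (new : Fresh n C L (q , i₀)) →
        (p∈L : (p , i) ∈ L) (p′∈L : (p′ , i′) ∈ L) →
        machine (E ⟦ app and (pair (fvar p) (fvar p′)) ⟧) C L ⟶am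
        machine (E ⟦ fvar q ⟧)
                (cnotNew new ((true , _ , p∈L) ∷ (true , _ , p′∈L) ∷ []) ∷ C)
                ((q , i₀) ∷ L)

  xor : ∀ {C L p i p′ i′ q i₀} (E : Context 0 l) (new : Fresh n C L (q , i₀)) →
        (p∈L : (p , i) ∈ L) (p′∈L : (p′ , i′) ∈ L) →
        machine (E ⟦ app xor (pair (fvar p) (fvar p′)) ⟧) C L ⟶am
        machine (E ⟦ fvar q ⟧)
                (cnotNew new ((true , _ , p∈L) ∷ []) ∷
                 cnotNew new ((true , _ , p′∈L) ∷ []) ∷ C)
                ((q , i₀) ∷ L)

  -- The gates may be added in any order.
  if-same : ∀ {C L p i Gs} (E : Context 0 l) (V W U : Tree Binding) →
            (p∈L : (p , i) ∈ L) (V∈L : Extension L V) (W∈L : Extension L W) →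
            SameShape V W → SameShape V U →
            (new : All (Fresh n C L) (leaves U)) →
            Unique (domain (leaves U)) → Unique (range (leaves U)) →
            Gs ↭ ifGates p∈L new V∈L W∈L →
            machine (E ⟦ ite (fvar p) ⌜ V ⌝ ⌜ W ⌝ ⟧) C L ⟶am
            machine (E ⟦ ⌜ U ⌝ ⟧) (Gs ++ C) (leaves U ++ L)

  if-err : ∀ {C L p i} (E : Context 0 l) (V W : Tree Binding) →
           (p , i) ∈ L → Extension L V → Extension L W → ¬ SameShape V W →
           machine (E ⟦ ite (fvar p) ⌜ V ⌝ ⌜ W ⌝ ⟧) C L ⟶am
           machine (E ⟦ Err ⟧) C L

_⟶am*_ : Machine n → Machine n → Set
_⟶am*_ = Star _⟶am_

-- A name outside the domain of L is left unchanged; in a machine reachable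
-- from EmptyAM there is none.
readback : Machine n → Vec Bool n → Term 0
readback {n} (machine M C L) u =
  substNames (λ x → maybe′ (bool ∘ finalValuation (inputs n) C u) (fvar x) (linked L x)) M

{-# OPTIONS --safe #-}

-- For every input u, each transition of the machine is matched on readbacks
-- by at most one small step, since the gates added by a boolean rule act on new
-- wires only, under controls that they leave unchanged.  The exception is the
-- transition to Err, which is not a reduction; it replaces a subterm by Err, and
-- as Err never takes part in a redex, every later step can still be performed
-- before the replacement.  Hence M[u/x] reduces to a term from which the
-- readback is obtained by replacing subterms with Err, and a tuple of booleans
-- contains no Err.  This gives one direction; the other one follows by
-- confluence, and k = m by subject reduction.
module Submission where

open import Defs
open import Data.Bool using (Bool; true; false; if_then_else_; _∧_; not) renaming (_xor_ to _⊻_)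
open import Data.Bool.Properties using (xor-assoc; xor-comm; xor-identityʳ)
open import Data.Fin using (Fin; zero; suc)
open import Data.Fin.Properties using (toℕ-injective)
open import Data.List as List using (List; []; _∷_; _++_)
open import Data.List.Membership.Propositional using (_∈_; _∉_)
open import Data.List.Membership.Propositional.Properties using (∈-++⁺ˡ; ∈-++⁺ʳ; ∈-map⁺; ∈-map⁻)
open import Data.List.Properties using (foldr-++; map-++)
open import Data.List.Relation.Binary.Permutation.Propositional using (_↭_; refl; prep; swap; ↭-sym)
open import Data.List.Relation.Binary.Permutation.Propositional.Properties using (All-resp-↭)
open import Data.List.Relation.Binary.Pointwise as Pointwise using (Pointwise; []; _∷_)
open import Data.List.Relation.Binary.Subset.Propositional using (_⊆_)
open import Data.List.Relation.Unary.All as All using (All; []; _∷_)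
import Data.List.Relation.Unary.All.Properties as All
open import Data.List.Relation.Unary.AllPairs using ([]; _∷_)
open import Data.List.Relation.Unary.Any using (here; there)
import Data.List.Relation.Unary.Unique.Propositional as Listᵁ
import Data.List.Relation.Unary.Unique.Propositional.Properties as Listᵁ
open import Data.Maybe using (just; nothing; maybe′)
open import Data.Nat using (ℕ; zero; suc; _≡ᵇ_; _≟_)
open import Data.Nat.Properties using (suc-injective)
open import Data.Product using (∃; _×_; _,_; proj₁; proj₂)
open import Data.Sum using (_⊎_; inj₁; inj₂)
open import Data.Unit using (⊤; tt)
open import Data.Vec as Vec using (Vec; []; _∷_; lookup; map)
open import Data.Vec.Properties using (∷-injectiveʳ)
open import Data.Vec.Relation.Binary.Pointwise.Inductive as Vecᴾ using ([]; _∷_)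
open import Data.Vec.Relation.Unary.All as Vecᴬ using ([]; _∷_)
import Data.Vec.Relation.Unary.All.Properties as Vecᴬ
open import Data.Vec.Relation.Unary.AllPairs using ([]; _∷_)
open import Data.Vec.Relation.Unary.Unique.Propositional using (Unique)
import Data.Vec.Relation.Unary.Unique.Propositional.Properties as Vecᵁ
open import Function using (_∘_)
open import Function.Bundles using (_⇔_; mk⇔)
open import Relation.Binary.Construct.Closure.ReflexiveTransitive using (Star; ε; _◅_; _◅◅_; gmap)
open import Relation.Binary.PropositionalEquality as ≡ using (_≡_; _≢_; refl; sym; trans; cong; cong₂)
open import Relation.Nullary using (yes; no)
open import Relation.Nullary.Decidable using (dec-true; dec-false)

-- When the branches of a conditional have different shapes, no single tree of new variables can
-- stand for both, so the machine gives up, whereas the small-step semantics still selects a branch.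
-- A step-by-step match would be lost from there on, even if the conditional is later discarded;
-- hence erasure is kept as a last phase after all reductions rather than mixed with them. Typing
-- does more than count components. It keeps every free name of the term in the domain of the
-- linking, so that a fresh name cannot occur in the rest of the term, and added links and gates
-- leave its readback unchanged. It also makes the readback of the final machine a tuple of booleans
-- for every input, with which any other boolean tuple reached from the `let` is compared. Since
-- reduction takes place in all contexts, it is not deterministic, and this comparison goes through
-- parallel reduction.

private variable
  j k l n : ℕ

cong₃ : ∀ {A B C D : Set} (f : A → B → C → D) {a a′ b b′ c c′} →
        a ≡ a′ → b ≡ b′ → c ≡ c′ → f a b c ≡ f a′ b′ c′
cong₃ f refl refl refl = refl

-- Substitution

lift-∘ : {ρ : Fin k → Fin l} {ρ′ : Fin l → Fin j} {ρ″ : Fin k → Fin j} →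
         (∀ i → ρ′ (ρ i) ≡ ρ″ i) → ∀ i → lift ρ′ (lift ρ i) ≡ lift ρ″ i
lift-∘ h zero    = refl
lift-∘ h (suc i) = cong suc (h i)

-- The composite is a third function given by a pointwise equation, here and in the laws below:
-- under a binder `lift-∘` supplies the equation again, and no function extensionality is called
-- for.
rename-∘ : {ρ : Fin k → Fin l} {ρ′ : Fin l → Fin j} {ρ″ : Fin k → Fin j} →
           (∀ i → ρ′ (ρ i) ≡ ρ″ i) → ∀ M → rename ρ′ (rename ρ M) ≡ rename ρ″ M
rename-∘ h (bvar i) = cong bvar (h i)
rename-∘ h (fvar x) = refl
rename-∘ h (lam M) = cong lam (rename-∘ (lift-∘ h) M)
rename-∘ h (app M N) = cong₂ app (rename-∘ h M) (rename-∘ h N)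
rename-∘ h (pair M N) = cong₂ pair (rename-∘ h M) (rename-∘ h N)
rename-∘ h (π₁ M) = cong π₁ (rename-∘ h M)
rename-∘ h (π₂ M) = cong π₂ (rename-∘ h M)
rename-∘ h skip = refl
rename-∘ h (letskip M N) = cong₂ letskip (rename-∘ h M) (rename-∘ h N)
rename-∘ h tt = refl
rename-∘ h ff = refl
rename-∘ h (ite P M N) = cong₃ ite (rename-∘ h P) (rename-∘ h M) (rename-∘ h N)
rename-∘ h and = refl
rename-∘ h xor = refl
rename-∘ h neg = refl
rename-∘ h (inj₁ M) = cong inj₁ (rename-∘ h M)
rename-∘ h (inj₂ M) = cong inj₂ (rename-∘ h M)
rename-∘ h (match P M N) = cong₃ match (rename-∘ h P) (rename-∘ (lift-∘ h) M) (rename-∘ (lift-∘ h) N)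
rename-∘ h split = refl
rename-∘ h (Y M) = cong Y (rename-∘ h M)
rename-∘ h Err = refl

rename-weaken : (ρ : Fin k → Fin l) (M : Term k) → rename (lift ρ) (weaken M) ≡ weaken (rename ρ M)
rename-weaken ρ M = trans (rename-∘ (λ _ → refl) M) (sym (rename-∘ (λ _ → refl) M))

lifts-lift : {ρ : Fin k → Fin l} {σ : Fin l → Term j} {σ″ : Fin k → Term j} →
             (∀ i → σ (ρ i) ≡ σ″ i) → ∀ i → lifts σ (lift ρ i) ≡ lifts σ″ i
lifts-lift h zero    = refl
lifts-lift h (suc i) = cong weaken (h i)

subst-rename : {ρ : Fin k → Fin l} {σ : Fin l → Term j} {σ″ : Fin k → Term j} {ν : Name → Term j} →
               (∀ i → σ (ρ i) ≡ σ″ i) → ∀ M → subst σ ν (rename ρ M) ≡ subst σ″ ν M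
subst-rename h (bvar i) = h i
subst-rename h (fvar x) = refl
subst-rename h (lam M) = cong lam (subst-rename (lifts-lift h) M)
subst-rename h (app M N) = cong₂ app (subst-rename h M) (subst-rename h N)
subst-rename h (pair M N) = cong₂ pair (subst-rename h M) (subst-rename h N)
subst-rename h (π₁ M) = cong π₁ (subst-rename h M)
subst-rename h (π₂ M) = cong π₂ (subst-rename h M)
subst-rename h skip = refl
subst-rename h (letskip M N) = cong₂ letskip (subst-rename h M) (subst-rename h N)
subst-rename h tt = refl
subst-rename h ff = refl
subst-rename h (ite P M N) = cong₃ ite (subst-rename h P) (subst-rename h M) (subst-rename h N)
subst-rename h and = refl
subst-rename h xor = refl
subst-rename h neg = refl
subst-rename h (inj₁ M) = cong inj₁ (subst-rename h M)
subst-rename h (inj₂ M) = cong inj₂ (subst-rename h M)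
subst-rename h (match P M N) =
  cong₃ match (subst-rename h P) (subst-rename (lifts-lift h) M) (subst-rename (lifts-lift h) N)
subst-rename h split = refl
subst-rename h (Y M) = cong Y (subst-rename h M)
subst-rename h Err = refl

lift-lifts : {σ : Fin k → Term l} {ρ : Fin l → Fin j} {σ″ : Fin k → Term j} →
             (∀ i → rename ρ (σ i) ≡ σ″ i) → ∀ i → rename (lift ρ) (lifts σ i) ≡ lifts σ″ i
lift-lifts         h zero    = refl
lift-lifts {σ = σ} h (suc i) = trans (rename-weaken _ (σ i)) (cong weaken (h i))

rename-weaken-names : {ν : Name → Term l} {ρ : Fin l → Fin j} {ν″ : Name → Term j} →
               (∀ x → rename ρ (ν x) ≡ ν″ x) → ∀ x → rename (lift ρ) (weaken (ν x)) ≡ weaken (ν″ x)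
rename-weaken-names {ν = ν} h x = trans (rename-weaken _ (ν x)) (cong weaken (h x))

rename-subst : {σ : Fin k → Term l} {ν : Name → Term l} {ρ : Fin l → Fin j}
               {σ″ : Fin k → Term j} {ν″ : Name → Term j} →
               (∀ i → rename ρ (σ i) ≡ σ″ i) → (∀ x → rename ρ (ν x) ≡ ν″ x) →
               ∀ M → rename ρ (subst σ ν M) ≡ subst σ″ ν″ M
rename-subst h g (bvar i) = h i
rename-subst h g (fvar x) = g x
rename-subst h g (lam M) = cong lam (rename-subst (lift-lifts h) (rename-weaken-names g) M)
rename-subst h g (app M N) = cong₂ app (rename-subst h g M) (rename-subst h g N)
rename-subst h g (pair M N) = cong₂ pair (rename-subst h g M) (rename-subst h g N)
rename-subst h g (π₁ M) = cong π₁ (rename-subst h g M)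
rename-subst h g (π₂ M) = cong π₂ (rename-subst h g M)
rename-subst h g skip = refl
rename-subst h g (letskip M N) = cong₂ letskip (rename-subst h g M) (rename-subst h g N)
rename-subst h g tt = refl
rename-subst h g ff = refl
rename-subst h g (ite P M N) = cong₃ ite (rename-subst h g P) (rename-subst h g M) (rename-subst h g N)
rename-subst h g and = refl
rename-subst h g xor = refl
rename-subst h g neg = refl
rename-subst h g (inj₁ M) = cong inj₁ (rename-subst h g M)
rename-subst h g (inj₂ M) = cong inj₂ (rename-subst h g M)
rename-subst h g (match P M N) =
  cong₃ match (rename-subst h g P)
              (rename-subst (lift-lifts h) (rename-weaken-names g) M)
              (rename-subst (lift-lifts h) (rename-weaken-names g) N)
rename-subst h g split = refl
rename-subst h g (Y M) = cong Y (rename-subst h g M)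
rename-subst h g Err = refl

subst-weaken : (σ : Fin k → Term l) (ν : Name → Term l) (M : Term k) →
               subst (lifts σ) (weaken ∘ ν) (weaken M) ≡ weaken (subst σ ν M)
subst-weaken σ ν M =
  trans (subst-rename (λ _ → refl) M) (sym (rename-subst (λ _ → refl) (λ _ → refl) M))

lifts-lifts : {σ : Fin k → Term l} {σ′ : Fin l → Term j} {ν′ : Name → Term j} {σ″ : Fin k → Term j} →
              (∀ i → subst σ′ ν′ (σ i) ≡ σ″ i) →
              ∀ i → subst (lifts σ′) (weaken ∘ ν′) (lifts σ i) ≡ lifts σ″ i
lifts-lifts         h zero    = refl
lifts-lifts {σ = σ} h (suc i) = trans (subst-weaken _ _ (σ i)) (cong weaken (h i))

subst-weaken-names : (ν : Name → Term l) {σ′ : Fin l → Term j} {ν′ ν″ : Name → Term j} →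
                (∀ x → subst σ′ ν′ (ν x) ≡ ν″ x) →
                ∀ x → subst (lifts σ′) (weaken ∘ ν′) (weaken (ν x)) ≡ weaken (ν″ x)
subst-weaken-names ν h x = trans (subst-weaken _ _ (ν x)) (cong weaken (h x))

-- The last of four fusion laws. Its binder case needs substitution to commute with `weaken`, which
-- `subst-weaken` derives from the two laws mixing renaming and substitution.
subst-subst : {σ : Fin k → Term l} {ν : Name → Term l} {σ′ : Fin l → Term j} {ν′ : Name → Term j}
              {σ″ : Fin k → Term j} {ν″ : Name → Term j} →
              (∀ i → subst σ′ ν′ (σ i) ≡ σ″ i) → (∀ x → subst σ′ ν′ (ν x) ≡ ν″ x) →
              ∀ M → subst σ′ ν′ (subst σ ν M) ≡ subst σ″ ν″ M
subst-subst h g (bvar i) = h i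
subst-subst h g (fvar x) = g x
subst-subst {ν = ν} h g (lam M) = cong lam (subst-subst (lifts-lifts h) (subst-weaken-names ν g) M)
subst-subst h g (app M N) = cong₂ app (subst-subst h g M) (subst-subst h g N)
subst-subst h g (pair M N) = cong₂ pair (subst-subst h g M) (subst-subst h g N)
subst-subst h g (π₁ M) = cong π₁ (subst-subst h g M)
subst-subst h g (π₂ M) = cong π₂ (subst-subst h g M)
subst-subst h g skip = refl
subst-subst h g (letskip M N) = cong₂ letskip (subst-subst h g M) (subst-subst h g N)
subst-subst h g tt = refl
subst-subst h g ff = refl
subst-subst h g (ite P M N) = cong₃ ite (subst-subst h g P) (subst-subst h g M) (subst-subst h g N)
subst-subst h g and = refl
subst-subst h g xor = refl
subst-subst h g neg = refl
subst-subst h g (inj₁ M) = cong inj₁ (subst-subst h g M)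
subst-subst h g (inj₂ M) = cong inj₂ (subst-subst h g M)
subst-subst {ν =
  ν} h
     g
     (match P M N)
     =
     cong₃
     match
     (subst-subst h g P)
     (subst-subst (lifts-lifts h) (subst-weaken-names ν g) M)
     (subst-subst (lifts-lifts h) (subst-weaken-names ν g) N)
subst-subst h g split = refl
subst-subst h g (Y M) = cong Y (subst-subst h g M)
subst-subst h g Err = refl

lifts-bvar : {σ : Fin k → Term k} → (∀ i → σ i ≡ bvar i) → ∀ i → lifts σ i ≡ bvar i
lifts-bvar h zero    = refl
lifts-bvar h (suc i) = cong weaken (h i)

subst-id : {σ : Fin k → Term k} {ν : Name → Term k} →
           (∀ i → σ i ≡ bvar i) → (∀ x → ν x ≡ fvar x) → ∀ M → subst σ ν M ≡ M
subst-id h g (bvar i) = h i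
subst-id h g (fvar x) = g x
subst-id h g (lam M) = cong lam (subst-id (lifts-bvar h) (cong weaken ∘ g) M)
subst-id h g (app M N) = cong₂ app (subst-id h g M) (subst-id h g N)
subst-id h g (pair M N) = cong₂ pair (subst-id h g M) (subst-id h g N)
subst-id h g (π₁ M) = cong π₁ (subst-id h g M)
subst-id h g (π₂ M) = cong π₂ (subst-id h g M)
subst-id h g skip = refl
subst-id h g (letskip M N) = cong₂ letskip (subst-id h g M) (subst-id h g N)
subst-id h g tt = refl
subst-id h g ff = refl
subst-id h g (ite P M N) = cong₃ ite (subst-id h g P) (subst-id h g M) (subst-id h g N)
subst-id h g and = refl
subst-id h g xor = refl
subst-id h g neg = refl
subst-id h g (inj₁ M) = cong inj₁ (subst-id h g M)
subst-id h g (inj₂ M) = cong inj₂ (subst-id h g M)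
subst-id h g (match P M N) =
  cong₃ match (subst-id h g P)
              (subst-id (lifts-bvar h) (cong weaken ∘ g) M)
              (subst-id (lifts-bvar h) (cong weaken ∘ g) N)
subst-id h g split = refl
subst-id h g (Y M) = cong Y (subst-id h g M)
subst-id h g Err = refl

-- No induction of its own: once the left side is followed by the identity substitution,
-- `subst-subst` can fuse it into any pointwise equal substitution.
subst-cong : {σ σ′ : Fin k → Term l} {ν ν′ : Name → Term l} →
             (∀ i → σ i ≡ σ′ i) → (∀ x → ν x ≡ ν′ x) → ∀ M → subst σ ν M ≡ subst σ′ ν′ M
subst-cong {l = l} h g M =
  trans (sym (id _)) (subst-subst (λ i → trans (id _) (h i)) (λ x → trans (id _) (g x)) M)
  where
  id : (M : Term l) → subst bvar fvar M ≡ M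
  id = subst-id (λ _ → refl) (λ _ → refl)

weaken-[] : (M N : Term k) → weaken M [ N ] ≡ M
weaken-[] M N = trans (subst-rename (λ _ → refl) M) (subst-id (λ _ → refl) (λ _ → refl) M)

-- Both sides are the one simultaneous substitution `σN`. On the right, the weakening of the
-- substituted terms is cancelled by `weaken-[]`.
subst-[] : (σ : Fin k → Term l) (ν : Name → Term l) (M : Term (suc k)) (N : Term k) →
           subst σ ν (M [ N ]) ≡ subst (lifts σ) (weaken ∘ ν) M [ subst σ ν N ]
subst-[] {k} {l} σ ν M N =
  trans (subst-subst {σ″ = σN} left (λ _ → refl) M)
        (sym (subst-subst {σ″ = σN} right (λ x → weaken-[] (ν x) _) M))
  where
  σN : Fin (suc k) → Term l
  σN zero    = subst σ ν N
  σN (suc i) = σ i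
  left : ∀ i → subst σ ν (single N i) ≡ σN i
  left zero    = refl
  left (suc i) = refl
  right : ∀ i → lifts σ i [ subst σ ν N ] ≡ σN i
  right zero    = refl
  right (suc i) = weaken-[] (σ i) _

rename-[] : (ρ : Fin k → Fin l) (M : Term (suc k)) (N : Term k) →
            rename ρ (M [ N ]) ≡ rename (lift ρ) M [ rename ρ N ]
rename-[] {k} {l} ρ M N =
  trans (rename-subst {σ″ = ρN} left (λ _ → refl) M) (sym (subst-rename right M))
  where
  ρN : Fin (suc k) → Term l
  ρN zero    = rename ρ N
  ρN (suc i) = bvar (ρ i)
  left : ∀ i → rename ρ (single N i) ≡ ρN i
  left zero    = refl
  left (suc i) = refl
  right : ∀ i → single (rename ρ N) (lift ρ i) ≡ ρN i
  right zero    = refl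
  right (suc i) = refl

rename-bool : (ρ : Fin k → Fin l) (b : Bool) → rename ρ (bool b) ≡ bool b
rename-bool ρ true  = refl
rename-bool ρ false = refl

subst-bool : (σ : Fin k → Term l) (ν : Name → Term l) (b : Bool) → subst σ ν (bool b) ≡ bool b
subst-bool σ ν true  = refl
subst-bool σ ν false = refl

-- Parallel reduction and erasure

-- Indexing one family by the mode lets reflexivity, renaming, substitution and closure under
-- contexts be proved once for both relations.
data Mode : Set where
  reduce erase : Mode

private variable
  μ : Mode

-- A predicate instead of the function `bool` in the arguments of an operation: case analysis on
-- derivations from a fixed term would get stuck on `bool b`, which is not a constructor form.
data Literal {k} : Term k → Bool → Set where
  tt : Literal tt true
  ff : Literal ff false

data Operation {k} : Term k → Term k → Bool → Set where
  neg : ∀ {N b} → Literal N b → Operation neg N (not b)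
  and : ∀ {M N a b} → Literal M a → Literal N b → Operation and (pair M N) (a ∧ b)
  xor : ∀ {M N a b} → Literal M a → Literal N b → Operation xor (pair M N) (a ⊻ b)

infix 4 _⊢_⇛_

-- reduce ⊢ M ⇛ N is parallel reduction, while erase ⊢ M ⇛ N says that N
-- arises from M by replacing subterms with Err; both contain the same
-- congruence rules.
data _⊢_⇛_ : Mode → Term k → Term k → Set where
  bvar    : (i : Fin k) → μ ⊢ bvar i ⇛ bvar i
  fvar    : (x : Name) → μ ⊢ fvar {k} x ⇛ fvar x
  lam     : {M M′ : Term (suc k)} → μ ⊢ M ⇛ M′ → μ ⊢ lam M ⇛ lam M′
  app     : {M M′ N N′ : Term k} → μ ⊢ M ⇛ M′ → μ ⊢ N ⇛ N′ → μ ⊢ app M N ⇛ app M′ N′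
  pair    : {M M′ N N′ : Term k} → μ ⊢ M ⇛ M′ → μ ⊢ N ⇛ N′ → μ ⊢ pair M N ⇛ pair M′ N′
  π₁      : {M M′ : Term k} → μ ⊢ M ⇛ M′ → μ ⊢ π₁ M ⇛ π₁ M′
  π₂      : {M M′ : Term k} → μ ⊢ M ⇛ M′ → μ ⊢ π₂ M ⇛ π₂ M′
  skip    : μ ⊢ skip {k} ⇛ skip
  letskip : {M M′ N N′ : Term k} → μ ⊢ M ⇛ M′ → μ ⊢ N ⇛ N′ → μ ⊢ letskip M N ⇛ letskip M′ N′
  tt      : μ ⊢ tt {k} ⇛ tt
  ff      : μ ⊢ ff {k} ⇛ ff
  ite     : {P P′ M M′ N N′ : Term k} →
            μ ⊢ P ⇛ P′ → μ ⊢ M ⇛ M′ → μ ⊢ N ⇛ N′ → μ ⊢ ite P M N ⇛ ite P′ M′ N′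
  and     : μ ⊢ and {k} ⇛ and
  xor     : μ ⊢ xor {k} ⇛ xor
  neg     : μ ⊢ neg {k} ⇛ neg
  inj₁    : {M M′ : Term k} → μ ⊢ M ⇛ M′ → μ ⊢ inj₁ M ⇛ inj₁ M′
  inj₂    : {M M′ : Term k} → μ ⊢ M ⇛ M′ → μ ⊢ inj₂ M ⇛ inj₂ M′
  match   : {P P′ : Term k} {M M′ N N′ : Term (suc k)} →
            μ ⊢ P ⇛ P′ → μ ⊢ M ⇛ M′ → μ ⊢ N ⇛ N′ → μ ⊢ match P M N ⇛ match P′ M′ N′
  split   : μ ⊢ split {k} ⇛ split
  Y       : {M M′ : Term k} → μ ⊢ M ⇛ M′ → μ ⊢ Y M ⇛ Y M′
  Err     : μ ⊢ Err {k} ⇛ Err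

  err      : {M : Term k} → erase ⊢ M ⇛ Err

  β        : {M M′ : Term (suc k)} {N N′ : Term k} →
             reduce ⊢ M ⇛ M′ → reduce ⊢ N ⇛ N′ → reduce ⊢ app (lam M) N ⇛ M′ [ N′ ]
  π₁β      : {M M′ N : Term k} → reduce ⊢ M ⇛ M′ → reduce ⊢ π₁ (pair M N) ⇛ M′
  π₂β      : {M N N′ : Term k} → reduce ⊢ N ⇛ N′ → reduce ⊢ π₂ (pair M N) ⇛ N′
  letskipβ : {M M′ : Term k} → reduce ⊢ M ⇛ M′ → reduce ⊢ letskip skip M ⇛ M′
  splitβ   : {M M′ : Term k} → reduce ⊢ M ⇛ M′ → reduce ⊢ app split M ⇛ M′
  match₁   : {P P′ : Term k} {M M′ N : Term (suc k)} →
             reduce ⊢ P ⇛ P′ → reduce ⊢ M ⇛ M′ → reduce ⊢ match (inj₁ P) M N ⇛ M′ [ P′ ]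
  match₂   : {P P′ : Term k} {M N N′ : Term (suc k)} →
             reduce ⊢ P ⇛ P′ → reduce ⊢ N ⇛ N′ → reduce ⊢ match (inj₂ P) M N ⇛ N′ [ P′ ]
  Yβ       : {M M′ : Term k} → reduce ⊢ M ⇛ M′ → reduce ⊢ Y M ⇛ app M′ (Y M′)
  if-tt    : {M M′ N : Term k} → reduce ⊢ M ⇛ M′ → reduce ⊢ ite tt M N ⇛ M′
  if-ff    : {M N N′ : Term k} → reduce ⊢ N ⇛ N′ → reduce ⊢ ite ff M N ⇛ N′
  δ        : {M N : Term k} {b : Bool} → Operation M N b → reduce ⊢ app M N ⇛ bool b

⇛-refl : {M : Term k} → μ ⊢ M ⇛ M
⇛-refl {M = bvar i} = bvar i
⇛-refl {M = fvar x} = fvar x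
⇛-refl {M = lam _} = lam ⇛-refl
⇛-refl {M = app _ _} = app ⇛-refl ⇛-refl
⇛-refl {M = pair _ _} = pair ⇛-refl ⇛-refl
⇛-refl {M = π₁ _} = π₁ ⇛-refl
⇛-refl {M = π₂ _} = π₂ ⇛-refl
⇛-refl {M = skip} = skip
⇛-refl {M = letskip _ _} = letskip ⇛-refl ⇛-refl
⇛-refl {M = tt} = tt
⇛-refl {M = ff} = ff
⇛-refl {M = ite _ _ _} = ite ⇛-refl ⇛-refl ⇛-refl
⇛-refl {M = and} = and
⇛-refl {M = xor} = xor
⇛-refl {M = neg} = neg
⇛-refl {M = inj₁ _} = inj₁ ⇛-refl
⇛-refl {M = inj₂ _} = inj₂ ⇛-refl
⇛-refl {M = match _ _ _} = match ⇛-refl ⇛-refl ⇛-refl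
⇛-refl {M = split} = split
⇛-refl {M = Y _} = Y ⇛-refl
⇛-refl {M = Err} = Err

⇛-target : {M N N′ : Term k} → N ≡ N′ → μ ⊢ M ⇛ N → μ ⊢ M ⇛ N′
⇛-target refl d = d

literal-rename : {N : Term k} {b : Bool} (ρ : Fin k → Fin l) → Literal N b → Literal (rename ρ N) b
literal-rename ρ tt = tt
literal-rename ρ ff = ff

operation-rename : {M N : Term k} {b : Bool} (ρ : Fin k → Fin l) →
                   Operation M N b → Operation (rename ρ M) (rename ρ N) b
operation-rename ρ (neg b)   = neg (literal-rename ρ b)
operation-rename ρ (and a b) = and (literal-rename ρ a) (literal-rename ρ b)
operation-rename ρ (xor a b) = xor (literal-rename ρ a) (literal-rename ρ b)

⇛-rename : {M N : Term k} (ρ : Fin k → Fin l) → μ ⊢ M ⇛ N → μ ⊢ rename ρ M ⇛ rename ρ N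
⇛-rename ρ (bvar i) = bvar (ρ i)
⇛-rename ρ (fvar x) = fvar x
⇛-rename ρ (lam d) = lam (⇛-rename (lift ρ) d)
⇛-rename ρ (app d e) = app (⇛-rename ρ d) (⇛-rename ρ e)
⇛-rename ρ (pair d e) = pair (⇛-rename ρ d) (⇛-rename ρ e)
⇛-rename ρ (π₁ d) = π₁ (⇛-rename ρ d)
⇛-rename ρ (π₂ d) = π₂ (⇛-rename ρ d)
⇛-rename ρ skip = skip
⇛-rename ρ (letskip d e) = letskip (⇛-rename ρ d) (⇛-rename ρ e)
⇛-rename ρ tt = tt
⇛-rename ρ ff = ff
⇛-rename ρ (ite d e f) = ite (⇛-rename ρ d) (⇛-rename ρ e) (⇛-rename ρ f)
⇛-rename ρ and = and
⇛-rename ρ xor = xor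
⇛-rename ρ neg = neg
⇛-rename ρ (inj₁ d) = inj₁ (⇛-rename ρ d)
⇛-rename ρ (inj₂ d) = inj₂ (⇛-rename ρ d)
⇛-rename ρ (match d e f) = match (⇛-rename ρ d) (⇛-rename (lift ρ) e) (⇛-rename (lift ρ) f)
⇛-rename ρ split = split
⇛-rename ρ (Y d) = Y (⇛-rename ρ d)
⇛-rename ρ Err = Err
⇛-rename ρ err = err
⇛-rename ρ (β {M′ = M} {N′ = N} d e) =
  ⇛-target (sym (rename-[] ρ M N)) (β (⇛-rename (lift ρ) d) (⇛-rename ρ e))
⇛-rename ρ (π₁β d) = π₁β (⇛-rename ρ d)
⇛-rename ρ (π₂β d) = π₂β (⇛-rename ρ d)
⇛-rename ρ (letskipβ d) = letskipβ (⇛-rename ρ d)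
⇛-rename ρ (splitβ d) = splitβ (⇛-rename ρ d)
⇛-rename ρ (match₁ {P′ = P} {M′ = M} d e) =
  ⇛-target (sym (rename-[] ρ M P)) (match₁ (⇛-rename ρ d) (⇛-rename (lift ρ) e))
⇛-rename ρ (match₂ {P′ = P} {N′ = N} d e) =
  ⇛-target (sym (rename-[] ρ N P)) (match₂ (⇛-rename ρ d) (⇛-rename (lift ρ) e))
⇛-rename ρ (Yβ d) = Yβ (⇛-rename ρ d)
⇛-rename ρ (if-tt d) = if-tt (⇛-rename ρ d)
⇛-rename ρ (if-ff d) = if-ff (⇛-rename ρ d)
⇛-rename ρ (δ {b = b} o) = ⇛-target (sym (rename-bool ρ b)) (δ (operation-rename ρ o))

literal-subst : {N : Term k} {b : Bool} (σ : Fin k → Term l) (ν : Name → Term l) →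
                Literal N b → Literal (subst σ ν N) b
literal-subst σ ν tt = tt
literal-subst σ ν ff = ff

operation-subst : {M N : Term k} {b : Bool} (σ : Fin k → Term l) (ν : Name → Term l) →
                  Operation M N b → Operation (subst σ ν M) (subst σ ν N) b
operation-subst σ ν (neg b)   = neg (literal-subst σ ν b)
operation-subst σ ν (and a b) = and (literal-subst σ ν a) (literal-subst σ ν b)
operation-subst σ ν (xor a b) = xor (literal-subst σ ν a) (literal-subst σ ν b)

⇛-lifts : {σ σ′ : Fin k → Term l} → (∀ i → μ ⊢ σ i ⇛ σ′ i) → ∀ i → μ ⊢ lifts σ i ⇛ lifts σ′ i
⇛-lifts s zero    = bvar zero
⇛-lifts s (suc i) = ⇛-rename suc (s i)

⇛-subst : {σ σ′ : Fin k → Term l} {M N : Term k} → (∀ i → μ ⊢ σ i ⇛ σ′ i) →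
          μ ⊢ M ⇛ N → μ ⊢ subst σ fvar M ⇛ subst σ′ fvar N
⇛-subst s (bvar i) = s i
⇛-subst s (fvar x) = fvar x
⇛-subst s (lam d) = lam (⇛-subst (⇛-lifts s) d)
⇛-subst s (app d e) = app (⇛-subst s d) (⇛-subst s e)
⇛-subst s (pair d e) = pair (⇛-subst s d) (⇛-subst s e)
⇛-subst s (π₁ d) = π₁ (⇛-subst s d)
⇛-subst s (π₂ d) = π₂ (⇛-subst s d)
⇛-subst s skip = skip
⇛-subst s (letskip d e) = letskip (⇛-subst s d) (⇛-subst s e)
⇛-subst s tt = tt
⇛-subst s ff = ff
⇛-subst s (ite d e f) = ite (⇛-subst s d) (⇛-subst s e) (⇛-subst s f)
⇛-subst s and = and
⇛-subst s xor = xor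
⇛-subst s neg = neg
⇛-subst s (inj₁ d) = inj₁ (⇛-subst s d)
⇛-subst s (inj₂ d) = inj₂ (⇛-subst s d)
⇛-subst s (match d e f) = match (⇛-subst s d) (⇛-subst (⇛-lifts s) e) (⇛-subst (⇛-lifts s) f)
⇛-subst s split = split
⇛-subst s (Y d) = Y (⇛-subst s d)
⇛-subst s Err = Err
⇛-subst s err = err
⇛-subst s (β {M′ = M} {N′ = N} d e) =
  ⇛-target (sym (subst-[] _ fvar M N)) (β (⇛-subst (⇛-lifts s) d) (⇛-subst s e))
⇛-subst s (π₁β d) = π₁β (⇛-subst s d)
⇛-subst s (π₂β d) = π₂β (⇛-subst s d)
⇛-subst s (letskipβ d) = letskipβ (⇛-subst s d)
⇛-subst s (splitβ d) = splitβ (⇛-subst s d)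
⇛-subst s (match₁ {P′ = P} {M′ = M} d e) =
  ⇛-target (sym (subst-[] _ fvar M P)) (match₁ (⇛-subst s d) (⇛-subst (⇛-lifts s) e))
⇛-subst s (match₂ {P′ = P} {N′ = N} d e) =
  ⇛-target (sym (subst-[] _ fvar N P)) (match₂ (⇛-subst s d) (⇛-subst (⇛-lifts s) e))
⇛-subst s (Yβ d) = Yβ (⇛-subst s d)
⇛-subst s (if-tt d) = if-tt (⇛-subst s d)
⇛-subst s (if-ff d) = if-ff (⇛-subst s d)
⇛-subst s (δ {b = b} o) = ⇛-target (sym (subst-bool _ fvar b)) (δ (operation-subst _ fvar o))

-- The reason for working with parallel steps: all copies of the argument move together with the
-- body in one step, however often the variable occurs.
⇛-[] : {M M′ : Term (suc k)} {N N′ : Term k} → μ ⊢ M ⇛ M′ → μ ⊢ N ⇛ N′ → μ ⊢ M [ N ] ⇛ M′ [ N′ ]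
⇛-[] {μ = μ} {N = N} {N′} d e = ⇛-subst s d
  where
  s : ∀ i → μ ⊢ single N i ⇛ single N′ i
  s zero    = e
  s (suc i) = bvar i

-- Confluence

literal-unique : {N : Term k} {a b : Bool} → Literal N a → Literal N b → a ≡ b
literal-unique tt tt = refl
literal-unique ff ff = refl

operation-unique : {M N : Term k} {a b : Bool} → Operation M N a → Operation M N b → a ≡ b
operation-unique (neg a)   (neg b)   = cong not (literal-unique a b)
operation-unique (and a b) (and c d) = cong₂ _∧_ (literal-unique a c) (literal-unique b d)
operation-unique (xor a b) (xor c d) = cong₂ _⊻_ (literal-unique a c) (literal-unique b d)

literal-⇛ : {N N′ : Term k} {b : Bool} → Literal N b → reduce ⊢ N ⇛ N′ → Literal N′ b
literal-⇛ tt tt = tt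
literal-⇛ ff ff = ff

operation-⇛ : {M M′ N N′ : Term k} {b : Bool} → Operation M N b →
              reduce ⊢ M ⇛ M′ → reduce ⊢ N ⇛ N′ → Operation M′ N′ b
operation-⇛ (neg b)   neg d          = neg (literal-⇛ b d)
operation-⇛ (and a b) and (pair d e) = and (literal-⇛ a d) (literal-⇛ b e)
operation-⇛ (xor a b) xor (pair d e) = xor (literal-⇛ a d) (literal-⇛ b e)

-- The method of Tait and Martin-Löf. The head constructors determine which rule contracts a term at
-- the root, so two contractions use the same rule. Against a congruence step, the redex survives
-- and is contracted afterwards.
diamond : {M N P : Term k} → reduce ⊢ M ⇛ N → reduce ⊢ M ⇛ P →
          ∃ λ Q → reduce ⊢ N ⇛ Q × reduce ⊢ P ⇛ Q
diamond (bvar i) (bvar i) = _ , bvar i , bvar i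
diamond (fvar x) (fvar x) = _ , fvar x , fvar x
diamond (lam d) (lam d′)
  with _ , a₁ , b₁ ← diamond d d′ =
  _ , lam a₁ , lam b₁
diamond (app d e) (app d′ e′)
  with _ , a₁ , b₁ ← diamond d d′ | _ , a₂ , b₂ ← diamond e e′ =
  _ , app a₁ a₂ , app b₁ b₂
diamond (pair d e) (pair d′ e′)
  with _ , a₁ , b₁ ← diamond d d′ | _ , a₂ , b₂ ← diamond e e′ =
  _ , pair a₁ a₂ , pair b₁ b₂
diamond (π₁ d) (π₁ d′)
  with _ , a₁ , b₁ ← diamond d d′ =
  _ , π₁ a₁ , π₁ b₁
diamond (π₂ d) (π₂ d′)
  with _ , a₁ , b₁ ← diamond d d′ =
  _ , π₂ a₁ , π₂ b₁
diamond skip skip = _ , skip , skip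
diamond (letskip d e) (letskip d′ e′)
  with _ , a₁ , b₁ ← diamond d d′ | _ , a₂ , b₂ ← diamond e e′ =
  _ , letskip a₁ a₂ , letskip b₁ b₂
diamond tt tt = _ , tt , tt
diamond ff ff = _ , ff , ff
diamond (ite d e f) (ite d′ e′ f′)
  with _ , a₁ , b₁ ← diamond d d′ | _ , a₂ , b₂ ← diamond e e′ | _ , a₃ , b₃ ← diamond f f′ =
  _ , ite a₁ a₂ a₃ , ite b₁ b₂ b₃
diamond and and = _ , and , and
diamond xor xor = _ , xor , xor
diamond neg neg = _ , neg , neg
diamond (inj₁ d) (inj₁ d′)
  with _ , a₁ , b₁ ← diamond d d′ =
  _ , inj₁ a₁ , inj₁ b₁
diamond (inj₂ d) (inj₂ d′)
  with _ , a₁ , b₁ ← diamond d d′ =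
  _ , inj₂ a₁ , inj₂ b₁
diamond (match d e f) (match d′ e′ f′)
  with _ , a₁ , b₁ ← diamond d d′ | _ , a₂ , b₂ ← diamond e e′ | _ , a₃ , b₃ ← diamond f f′ =
  _ , match a₁ a₂ a₃ , match b₁ b₂ b₃
diamond split split = _ , split , split
diamond (Y d) (Y d′)
  with _ , a₁ , b₁ ← diamond d d′ =
  _ , Y a₁ , Y b₁
diamond Err Err = _ , Err , Err
diamond (β d e) (β d′ e′) with _ , a₁ , b₁ ← diamond d d′ | _ , a₂ , b₂ ← diamond e e′ =
  _ , ⇛-[] a₁ a₂ , ⇛-[] b₁ b₂
diamond (β d e) (app (lam d′) e′) with _ , a₁ , b₁ ← diamond d d′ | _ , a₂ , b₂ ← diamond e e′ =
  _ , ⇛-[] a₁ a₂ , β b₁ b₂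
diamond (app (lam d) e) (β d′ e′) with _ , a₁ , b₁ ← diamond d d′ | _ , a₂ , b₂ ← diamond e e′ =
  _ , β a₁ a₂ , ⇛-[] b₁ b₂
diamond (π₁β d) (π₁β d′) = diamond d d′
diamond (π₁β d) (π₁ (pair d′ _)) with _ , a , b ← diamond d d′ = _ , a , π₁β b
diamond (π₁ (pair d _)) (π₁β d′) with _ , a , b ← diamond d d′ = _ , π₁β a , b
diamond (π₂β d) (π₂β d′) = diamond d d′
diamond (π₂β d) (π₂ (pair _ d′)) with _ , a , b ← diamond d d′ = _ , a , π₂β b
diamond (π₂ (pair _ d)) (π₂β d′) with _ , a , b ← diamond d d′ = _ , π₂β a , b
diamond (letskipβ d) (letskipβ d′) = diamond d d′
diamond (letskipβ d) (letskip skip d′) with _ , a , b ← diamond d d′ = _ , a , letskipβ b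
diamond (letskip skip d) (letskipβ d′) with _ , a , b ← diamond d d′ = _ , letskipβ a , b
diamond (splitβ d) (splitβ d′) = diamond d d′
diamond (splitβ d) (app split d′) with _ , a , b ← diamond d d′ = _ , a , splitβ b
diamond (app split d) (splitβ d′) with _ , a , b ← diamond d d′ = _ , splitβ a , b
diamond (match₁ d e) (match₁ d′ e′) with _ , a₁ , b₁ ← diamond d d′ | _ , a₂ , b₂ ← diamond e e′ =
  _ , ⇛-[] a₂ a₁ , ⇛-[] b₂ b₁
diamond (match₁ d e) (match (inj₁ d′) e′ _)
  with _ , a₁ , b₁ ← diamond d d′ | _ , a₂ , b₂ ← diamond e e′ = _ , ⇛-[] a₂ a₁ , match₁ b₁ b₂
diamond (match (inj₁ d) e _) (match₁ d′ e′)
  with _ , a₁ , b₁ ← diamond d d′ | _ , a₂ , b₂ ← diamond e e′ = _ , match₁ a₁ a₂ , ⇛-[] b₂ b₁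
diamond (match₂ d e) (match₂ d′ e′) with _ , a₁ , b₁ ← diamond d d′ | _ , a₂ , b₂ ← diamond e e′ =
  _ , ⇛-[] a₂ a₁ , ⇛-[] b₂ b₁
diamond (match₂ d e) (match (inj₂ d′) _ e′)
  with _ , a₁ , b₁ ← diamond d d′ | _ , a₂ , b₂ ← diamond e e′ = _ , ⇛-[] a₂ a₁ , match₂ b₁ b₂
diamond (match (inj₂ d) _ e) (match₂ d′ e′)
  with _ , a₁ , b₁ ← diamond d d′ | _ , a₂ , b₂ ← diamond e e′ = _ , match₂ a₁ a₂ , ⇛-[] b₂ b₁
diamond (Yβ d) (Yβ d′) with _ , a , b ← diamond d d′ = _ , app a (Y a) , app b (Y b)
diamond (Yβ d) (Y d′) with _ , a , b ← diamond d d′ = _ , app a (Y a) , Yβ b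
diamond (Y d) (Yβ d′) with _ , a , b ← diamond d d′ = _ , Yβ a , app b (Y b)
diamond (if-tt d) (if-tt d′) = diamond d d′
diamond (if-tt d) (ite tt d′ _) with _ , a , b ← diamond d d′ = _ , a , if-tt b
diamond (ite tt d _) (if-tt d′) with _ , a , b ← diamond d d′ = _ , if-tt a , b
diamond (if-ff d) (if-ff d′) = diamond d d′
diamond (if-ff d) (ite ff _ d′) with _ , a , b ← diamond d d′ = _ , a , if-ff b
diamond (ite ff _ d) (if-ff d′) with _ , a , b ← diamond d d′ = _ , if-ff a , b
diamond (δ o) (δ o′) = _ , ⇛-refl , ⇛-target (cong bool (operation-unique o′ o)) ⇛-refl
diamond (δ o) (app d e) = _ , ⇛-refl , δ (operation-⇛ o d e)
diamond (app d e) (δ o) = _ , δ (operation-⇛ o d e) , ⇛-refl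

⇛-⟦⟧ : (E : Context k l) {R R′ : Term l} → μ ⊢ R ⇛ R′ → μ ⊢ E ⟦ R ⟧ ⇛ E ⟦ R′ ⟧
⇛-⟦⟧ □ d = d
⇛-⟦⟧ (lam E) d = lam (⇛-⟦⟧ E d)
⇛-⟦⟧ (appˡ E _) d = app (⇛-⟦⟧ E d) ⇛-refl
⇛-⟦⟧ (appʳ _ E) d = app ⇛-refl (⇛-⟦⟧ E d)
⇛-⟦⟧ (pairˡ E _) d = pair (⇛-⟦⟧ E d) ⇛-refl
⇛-⟦⟧ (pairʳ _ E) d = pair ⇛-refl (⇛-⟦⟧ E d)
⇛-⟦⟧ (π₁ E) d = π₁ (⇛-⟦⟧ E d)
⇛-⟦⟧ (π₂ E) d = π₂ (⇛-⟦⟧ E d)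
⇛-⟦⟧ (letskipˡ E _) d = letskip (⇛-⟦⟧ E d) ⇛-refl
⇛-⟦⟧ (letskipʳ _ E) d = letskip ⇛-refl (⇛-⟦⟧ E d)
⇛-⟦⟧ (iteᶜ E _ _) d = ite (⇛-⟦⟧ E d) ⇛-refl ⇛-refl
⇛-⟦⟧ (iteᵗ _ E _) d = ite ⇛-refl (⇛-⟦⟧ E d) ⇛-refl
⇛-⟦⟧ (iteᵉ _ _ E) d = ite ⇛-refl ⇛-refl (⇛-⟦⟧ E d)
⇛-⟦⟧ (inj₁ E) d = inj₁ (⇛-⟦⟧ E d)
⇛-⟦⟧ (inj₂ E) d = inj₂ (⇛-⟦⟧ E d)
⇛-⟦⟧ (matchᶜ E _ _) d = match (⇛-⟦⟧ E d) ⇛-refl ⇛-refl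
⇛-⟦⟧ (matchˡ _ E _) d = match ⇛-refl (⇛-⟦⟧ E d) ⇛-refl
⇛-⟦⟧ (matchʳ _ _ E) d = match ⇛-refl ⇛-refl (⇛-⟦⟧ E d)
⇛-⟦⟧ (Y E) d = Y (⇛-⟦⟧ E d)

bool-literal : (b : Bool) → Literal {k} (bool b) b
bool-literal true  = tt
bool-literal false = ff

↦⇒⇛ : {R R′ : Term k} → R ↦ R′ → reduce ⊢ R ⇛ R′
↦⇒⇛ (β M N)        = β ⇛-refl ⇛-refl
↦⇒⇛ (π₁ M N)       = π₁β ⇛-refl
↦⇒⇛ (π₂ M N)       = π₂β ⇛-refl
↦⇒⇛ (letskip M)    = letskipβ ⇛-refl
↦⇒⇛ (split M)      = splitβ ⇛-refl
↦⇒⇛ (match₁ P M N) = match₁ ⇛-refl ⇛-refl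
↦⇒⇛ (match₂ P M N) = match₂ ⇛-refl ⇛-refl
↦⇒⇛ (Y M)          = Yβ ⇛-refl

↦ᵇ⇒⇛ : {R R′ : Term k} → R ↦ᵇ R′ → reduce ⊢ R ⇛ R′
↦ᵇ⇒⇛ (if-tt M N) = if-tt ⇛-refl
↦ᵇ⇒⇛ (if-ff M N) = if-ff ⇛-refl
↦ᵇ⇒⇛ (neg b)     = δ (neg (bool-literal b))
↦ᵇ⇒⇛ (and a b)   = δ (and (bool-literal a) (bool-literal b))
↦ᵇ⇒⇛ (xor a b)   = δ (xor (bool-literal a) (bool-literal b))

⟶⇒⇛ : {M N : Term k} → M ⟶ N → reduce ⊢ M ⇛ N
⟶⇒⇛ (pure E r)    = ⇛-⟦⟧ E (↦⇒⇛ r)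
⟶⇒⇛ (boolean E r) = ⇛-⟦⟧ E (↦ᵇ⇒⇛ r)

strip : {M N P : Term k} → reduce ⊢ M ⇛ N → Star (reduce ⊢_⇛_) M P →
        ∃ λ Q → Star (reduce ⊢_⇛_) N Q × reduce ⊢ P ⇛ Q
strip d ε        = _ , ε , d
strip d (e ◅ es) with _ , a , b ← diamond d e with _ , as , c ← strip b es = _ , a ◅ as , c

bool-normal : (b : Bool) {N : Term k} → reduce ⊢ bool b ⇛ N → N ≡ bool b
bool-normal true  tt = refl
bool-normal false ff = refl

tuple-normal : (c : Vec Bool n) {N : Term k} → reduce ⊢ tuple (map bool c) ⇛ N → N ≡ tuple (map bool c)
tuple-normal []          skip       = refl
tuple-normal (b ∷ [])    d          = bool-normal b d
tuple-normal (b ∷ a ∷ c) (pair d e) = cong₂ pair (bool-normal b d) (tuple-normal (a ∷ c) e)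

tuple-normal* : (c : Vec Bool n) {N : Term k} →
                Star (reduce ⊢_⇛_) (tuple (map bool c)) N → N ≡ tuple (map bool c)
tuple-normal* c ε        = refl
tuple-normal* c (d ◅ ds) with refl ← tuple-normal c d = tuple-normal* c ds

-- Induction on the first sequence. `strip` carries the second one across each step, and its
-- endpoint does not move, because a tuple of booleans reduces in parallel only to itself.
tuple-unique : (c : Vec Bool n) (d : Vec Bool l) {M : Term k} →
               Star (reduce ⊢_⇛_) M (tuple (map bool c)) → Star (reduce ⊢_⇛_) M (tuple (map bool d)) →
               tuple {k} (map bool c) ≡ tuple (map bool d)
tuple-unique c d ε        es = sym (tuple-normal* c es)
tuple-unique c d (e ◅ ds) es with _ , as , a ← strip e es with refl ← tuple-normal d a =
  tuple-unique c d ds as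

⟶*-tuple-unique : (c : Vec Bool n) (d : Vec Bool l) {M : Term k} →
                  M ⟶* tuple (map bool c) → M ⟶* tuple (map bool d) →
                  tuple {k} (map bool c) ≡ tuple (map bool d)
⟶*-tuple-unique c d rs ss =
  tuple-unique c d (gmap (λ M → M) ⟶⇒⇛ rs) (gmap (λ M → M) ⟶⇒⇛ ss)

-- Simulation of reduction through erasure

-- A view of the less erased term along `E`. The function in `covered` is the way back, for whatever
-- the hole of the recovered context is filled with.
data Covered {k l} (E : Context k l) (R : Term l) : Term k → Set where
  covered : (E′ : Context k l) {R′ : Term l} → erase ⊢ R′ ⇛ R →
            (∀ {P Q} → erase ⊢ P ⇛ Q → erase ⊢ E′ ⟦ P ⟧ ⇛ E ⟦ Q ⟧) → Covered E R (E′ ⟦ R′ ⟧)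

-- The rule `err` ends in `Err`, and no layer of a context is `Err`; so each layer visible after
-- erasure was already there before.
uncover : (E : Context k l) {R : Term l} {T : Term k} → erase ⊢ T ⇛ E ⟦ R ⟧ → Covered E R T
uncover □ d = covered □ d (λ c → c)
uncover (lam E) (lam d) with covered E′ d′ g ← uncover E d =
  covered (lam E′) d′ (λ c → lam (g c))
uncover (appˡ E N) (app d e) with covered E′ d′ g ← uncover E d =
  covered (appˡ E′ _) d′ (λ c → app (g c) e)
uncover (appʳ M E) (app d e) with covered E′ d′ g ← uncover E e =
  covered (appʳ _ E′) d′ (λ c → app d (g c))
uncover (pairˡ E N) (pair d e) with covered E′ d′ g ← uncover E d =
  covered (pairˡ E′ _) d′ (λ c → pair (g c) e)
uncover (pairʳ M E) (pair d e) with covered E′ d′ g ← uncover E e =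
  covered (pairʳ _ E′) d′ (λ c → pair d (g c))
uncover (π₁ E) (π₁ d) with covered E′ d′ g ← uncover E d =
  covered (π₁ E′) d′ (λ c → π₁ (g c))
uncover (π₂ E) (π₂ d) with covered E′ d′ g ← uncover E d =
  covered (π₂ E′) d′ (λ c → π₂ (g c))
uncover (letskipˡ E N) (letskip d e) with covered E′ d′ g ← uncover E d =
  covered (letskipˡ E′ _) d′ (λ c → letskip (g c) e)
uncover (letskipʳ M E) (letskip d e) with covered E′ d′ g ← uncover E e =
  covered (letskipʳ _ E′) d′ (λ c → letskip d (g c))
uncover (iteᶜ E M N) (ite d e f) with covered E′ d′ g ← uncover E d =
  covered (iteᶜ E′ _ _) d′ (λ c → ite (g c) e f)
uncover (iteᵗ P E N) (ite d e f) with covered E′ d′ g ← uncover E e =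
  covered (iteᵗ _ E′ _) d′ (λ c → ite d (g c) f)
uncover (iteᵉ P M E) (ite d e f) with covered E′ d′ g ← uncover E f =
  covered (iteᵉ _ _ E′) d′ (λ c → ite d e (g c))
uncover (inj₁ E) (inj₁ d) with covered E′ d′ g ← uncover E d =
  covered (inj₁ E′) d′ (λ c → inj₁ (g c))
uncover (inj₂ E) (inj₂ d) with covered E′ d′ g ← uncover E d =
  covered (inj₂ E′) d′ (λ c → inj₂ (g c))
uncover (matchᶜ E M N) (match d e f) with covered E′ d′ g ← uncover E d =
  covered (matchᶜ E′ _ _) d′ (λ c → match (g c) e f)
uncover (matchˡ P E N) (match d e f) with covered E′ d′ g ← uncover E e =
  covered (matchˡ _ E′ _) d′ (λ c → match d (g c) f)
uncover (matchʳ P M E) (match d e f) with covered E′ d′ g ← uncover E f =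
  covered (matchʳ _ _ E′) d′ (λ c → match d e (g c))
uncover (Y E) (Y d) with covered E′ d′ g ← uncover E d =
  covered (Y E′) d′ (λ c → Y (g c))

-- No rule inspects `Err`, so the constructors that make `R` a redex are those of `T` as well. The
-- contracta stay related because erasure is preserved by substitution.
↦-unerase : {T R R′ : Term k} → R ↦ R′ → erase ⊢ T ⇛ R → ∃ λ T′ → T ↦ T′ × erase ⊢ T′ ⇛ R′
↦-unerase (β M N)        (app (lam d) e)      = _ , β _ _ , ⇛-[] d e
↦-unerase (π₁ M N)       (π₁ (pair d e))      = _ , π₁ _ _ , d
↦-unerase (π₂ M N)       (π₂ (pair d e))      = _ , π₂ _ _ , e
↦-unerase (letskip M)    (letskip skip d)     = _ , letskip _ , d
↦-unerase (split M)      (app split d)        = _ , split _ , d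
↦-unerase (match₁ P M N) (match (inj₁ d) e f) = _ , match₁ _ _ _ , ⇛-[] e d
↦-unerase (match₂ P M N) (match (inj₂ d) e f) = _ , match₂ _ _ _ , ⇛-[] f d
↦-unerase (Y M)          (Y d)                = _ , Y _ , app d (Y d)

bool-unerase : (b : Bool) {T : Term k} → erase ⊢ T ⇛ bool b → T ≡ bool b
bool-unerase true  tt = refl
bool-unerase false ff = refl

↦ᵇ-unerase : {T R R′ : Term k} → R ↦ᵇ R′ → erase ⊢ T ⇛ R → ∃ λ T′ → T ↦ᵇ T′ × erase ⊢ T′ ⇛ R′
↦ᵇ-unerase (if-tt M N) (ite tt d e) = _ , if-tt _ _ , d
↦ᵇ-unerase (if-ff M N) (ite ff d e) = _ , if-ff _ _ , e
↦ᵇ-unerase (neg b) (app neg d) with refl ← bool-unerase b d = _ , neg b , ⇛-refl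
↦ᵇ-unerase (and a b) (app and (pair d e))
  with refl ← bool-unerase a d | refl ← bool-unerase b e = _ , and a b , ⇛-refl
↦ᵇ-unerase (xor a b) (app xor (pair d e))
  with refl ← bool-unerase a d | refl ← bool-unerase b e = _ , xor a b , ⇛-refl

infix 4 _⟶*⊒_

-- Reductions first, erasure last. The lemmas below keep this order: a reduction performed after
-- erasure is moved in front of it.
_⟶*⊒_ : Term k → Term k → Set
M ⟶*⊒ N = ∃ λ T → M ⟶* T × erase ⊢ T ⇛ N

⊒-pure : {M : Term k} (E : Context k l) {R R′ : Term l} →
         M ⟶*⊒ E ⟦ R ⟧ → R ↦ R′ → M ⟶*⊒ E ⟦ R′ ⟧
⊒-pure E (_ , rs , d) r with covered E′ d′ f ← uncover E d with _ , r′ , d″ ← ↦-unerase r d′ =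
  _ , rs ◅◅ pure E′ r′ ◅ ε , f d″

⊒-boolean : {M : Term k} (E : Context k l) {R R′ : Term l} →
            M ⟶*⊒ E ⟦ R ⟧ → R ↦ᵇ R′ → M ⟶*⊒ E ⟦ R′ ⟧
⊒-boolean E (_ , rs , d) r with covered E′ d′ f ← uncover E d with _ , r′ , d″ ← ↦ᵇ-unerase r d′ =
  _ , rs ◅◅ boolean E′ r′ ◅ ε , f d″

-- The reduction sequence is kept as it is; the replacement is absorbed by the erasure phase.
⊒-err : {M : Term k} (E : Context k l) {R : Term l} → M ⟶*⊒ E ⟦ R ⟧ → M ⟶*⊒ E ⟦ Err ⟧
⊒-err E (_ , rs , d) with covered E′ _ f ← uncover E d = _ , rs , f err

tuple-unerase : (c : Vec Bool n) {T : Term k} → erase ⊢ T ⇛ tuple (map bool c) → T ≡ tuple (map bool c)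
tuple-unerase []          skip       = refl
tuple-unerase (b ∷ [])    d          = bool-unerase b d
tuple-unerase (b ∷ a ∷ c) (pair d e) = cong₂ pair (bool-unerase b d) (tuple-unerase (a ∷ c) e)

-- Typing

private variable
  Δ Δ′ : List Name
  Γ Γ′ : Vec Type k
  A B  : Type

infix 4 _∣_⊩_∶_

-- The rule unfold is needed for subject reduction: split M has type
-- 𝟙 ⊕ (A ⊗ [ A ]ᵗ) and reduces to M, of which only the type [ A ]ᵗ is known.
data _∣_⊩_∶_ (Δ : List Name) {k} (Γ : Vec Type k) : Term k → Type → Set where
  fvar    : ∀ {x} → x ∈ Δ → Δ ∣ Γ ⊩ fvar x ∶ bit
  bvar    : ∀ {i A} → lookup Γ i ≡ A → Δ ∣ Γ ⊩ bvar i ∶ A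
  tt      : Δ ∣ Γ ⊩ tt ∶ bit
  ff      : Δ ∣ Γ ⊩ ff ∶ bit
  skip    : Δ ∣ Γ ⊩ skip ∶ 𝟙
  Err     : ∀ {A} → Δ ∣ Γ ⊩ Err ∶ A
  neg     : Δ ∣ Γ ⊩ neg ∶ bit ⇒ bit
  and     : Δ ∣ Γ ⊩ and ∶ bit ⊗ bit ⇒ bit
  xor     : Δ ∣ Γ ⊩ xor ∶ bit ⊗ bit ⇒ bit
  split   : ∀ {A} → Δ ∣ Γ ⊩ split ∶ [ A ]ᵗ ⇒ 𝟙 ⊕ (A ⊗ [ A ]ᵗ)
  lam     : ∀ {A B M} → Δ ∣ A ∷ Γ ⊩ M ∶ B → Δ ∣ Γ ⊩ lam M ∶ A ⇒ B
  app     : ∀ {A B M N} → Δ ∣ Γ ⊩ M ∶ A ⇒ B → Δ ∣ Γ ⊩ N ∶ A → Δ ∣ Γ ⊩ app M N ∶ B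
  pair    : ∀ {A B M N} → Δ ∣ Γ ⊩ M ∶ A → Δ ∣ Γ ⊩ N ∶ B → Δ ∣ Γ ⊩ pair M N ∶ A ⊗ B
  π₁      : ∀ {A B M} → Δ ∣ Γ ⊩ M ∶ A ⊗ B → Δ ∣ Γ ⊩ π₁ M ∶ A
  π₂      : ∀ {A B M} → Δ ∣ Γ ⊩ M ∶ A ⊗ B → Δ ∣ Γ ⊩ π₂ M ∶ B
  inj₁    : ∀ {A B M} → Δ ∣ Γ ⊩ M ∶ A → Δ ∣ Γ ⊩ inj₁ M ∶ A ⊕ B
  inj₂    : ∀ {A B M} → Δ ∣ Γ ⊩ M ∶ B → Δ ∣ Γ ⊩ inj₂ M ∶ A ⊕ B
  letskip : ∀ {A M N} → Δ ∣ Γ ⊩ M ∶ 𝟙 → Δ ∣ Γ ⊩ N ∶ A → Δ ∣ Γ ⊩ letskip M N ∶ A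
  match   : ∀ {A B C P M N} → Δ ∣ Γ ⊩ P ∶ A ⊕ B →
            Δ ∣ A ∷ Γ ⊩ M ∶ C → Δ ∣ B ∷ Γ ⊩ N ∶ C → Δ ∣ Γ ⊩ match P M N ∶ C
  fold    : ∀ {A M} → Δ ∣ Γ ⊩ M ∶ 𝟙 ⊕ (A ⊗ [ A ]ᵗ) → Δ ∣ Γ ⊩ M ∶ [ A ]ᵗ
  unfold  : ∀ {A M} → Δ ∣ Γ ⊩ M ∶ [ A ]ᵗ → Δ ∣ Γ ⊩ M ∶ 𝟙 ⊕ (A ⊗ [ A ]ᵗ)
  Y       : ∀ {A M} → Δ ∣ Γ ⊩ M ∶ A ⇒ A → Δ ∣ Γ ⊩ Y M ∶ A
  ite     : ∀ {C P M N} → Δ ∣ Γ ⊩ P ∶ bit →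
            Δ ∣ Γ ⊩ M ∶ C → Δ ∣ Γ ⊩ N ∶ C → Δ ∣ Γ ⊩ ite P M N ∶ C

⊢⇒⊩ : {Δ : NameContext} {Δ′ : List Name} {Γ : Vec Type k} {M : Term k} →
      (∀ {x B} → (x , B) ∈ Δ → x ∈ Δ′ × B ≡ bit) → Δ ∣ Γ ⊢ M ∶ A → Δ′ ∣ Γ ⊩ M ∶ A
⊢⇒⊩ h (fvar x∈Δ) with x∈Δ′ , refl ← h x∈Δ = fvar x∈Δ′
⊢⇒⊩ h (bvar i) = bvar refl
⊢⇒⊩ h (lam d) = lam (⊢⇒⊩ h d)
⊢⇒⊩ h (app d e) = app (⊢⇒⊩ h d) (⊢⇒⊩ h e)
⊢⇒⊩ h (pair d e) = pair (⊢⇒⊩ h d) (⊢⇒⊩ h e)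
⊢⇒⊩ h (π₁ d) = π₁ (⊢⇒⊩ h d)
⊢⇒⊩ h (π₂ d) = π₂ (⊢⇒⊩ h d)
⊢⇒⊩ h skip = skip
⊢⇒⊩ h (letskip d e) = letskip (⊢⇒⊩ h d) (⊢⇒⊩ h e)
⊢⇒⊩ h tt = tt
⊢⇒⊩ h ff = ff
⊢⇒⊩ h (ite _ d e f) = ite (⊢⇒⊩ h d) (⊢⇒⊩ h e) (⊢⇒⊩ h f)
⊢⇒⊩ h and = and
⊢⇒⊩ h xor = xor
⊢⇒⊩ h neg = neg
⊢⇒⊩ h (inj₁ d) = inj₁ (⊢⇒⊩ h d)
⊢⇒⊩ h (inj₂ d) = inj₂ (⊢⇒⊩ h d)
⊢⇒⊩ h (match d e f) = match (⊢⇒⊩ h d) (⊢⇒⊩ h e) (⊢⇒⊩ h f)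
⊢⇒⊩ h split = split
⊢⇒⊩ h (Y d) = Y (⊢⇒⊩ h d)
⊢⇒⊩ h Err = Err
⊢⇒⊩ h (fold d) = fold (⊢⇒⊩ h d)

lookup-lift : {ρ : Fin k → Fin l} → (∀ i → lookup Γ′ (ρ i) ≡ lookup Γ i) →
              ∀ i → lookup (A ∷ Γ′) (lift ρ i) ≡ lookup (A ∷ Γ) i
lookup-lift h zero    = refl
lookup-lift h (suc i) = h i

⊩-rename : {ρ : Fin k → Fin l} {M : Term k} → (∀ i → lookup Γ′ (ρ i) ≡ lookup Γ i) →
           Δ ∣ Γ ⊩ M ∶ A → Δ ∣ Γ′ ⊩ rename ρ M ∶ A
⊩-rename h (bvar {i} e) = bvar (trans (h i) e)
⊩-rename h (fvar x∈Δ) = fvar x∈Δ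
⊩-rename h (lam d) = lam (⊩-rename (lookup-lift h) d)
⊩-rename h (app d e) = app (⊩-rename h d) (⊩-rename h e)
⊩-rename h (pair d e) = pair (⊩-rename h d) (⊩-rename h e)
⊩-rename h (π₁ d) = π₁ (⊩-rename h d)
⊩-rename h (π₂ d) = π₂ (⊩-rename h d)
⊩-rename h skip = skip
⊩-rename h (letskip d e) = letskip (⊩-rename h d) (⊩-rename h e)
⊩-rename h tt = tt
⊩-rename h ff = ff
⊩-rename h (ite d e f) = ite (⊩-rename h d) (⊩-rename h e) (⊩-rename h f)
⊩-rename h and = and
⊩-rename h xor = xor
⊩-rename h neg = neg
⊩-rename h (inj₁ d) = inj₁ (⊩-rename h d)
⊩-rename h (inj₂ d) = inj₂ (⊩-rename h d)
⊩-rename h (match d e f) = match (⊩-rename h d) (⊩-rename (lookup-lift h) e) (⊩-rename (lookup-lift h) f)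
⊩-rename h split = split
⊩-rename h (Y d) = Y (⊩-rename h d)
⊩-rename h Err = Err
⊩-rename h (fold d) = fold (⊩-rename h d)
⊩-rename h (unfold d) = unfold (⊩-rename h d)

⊩-lifts : {σ : Fin k → Term l} → (∀ i → Δ ∣ Γ′ ⊩ σ i ∶ lookup Γ i) →
          ∀ i → Δ ∣ A ∷ Γ′ ⊩ lifts σ i ∶ lookup (A ∷ Γ) i
⊩-lifts s zero    = bvar refl
⊩-lifts s (suc i) = ⊩-rename (λ _ → refl) (s i)

⊩-subst : {σ : Fin k → Term l} {ν : Name → Term l} {M : Term k} →
          (∀ i → Δ′ ∣ Γ′ ⊩ σ i ∶ lookup Γ i) → (∀ {x} → x ∈ Δ → Δ′ ∣ Γ′ ⊩ ν x ∶ bit) →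
          Δ ∣ Γ ⊩ M ∶ A → Δ′ ∣ Γ′ ⊩ subst σ ν M ∶ A
⊩-subst s t (bvar {i} refl) = s i
⊩-subst s t (fvar x∈Δ) = t x∈Δ
⊩-subst s t (lam d) = lam (⊩-subst (⊩-lifts s) (⊩-rename (λ _ → refl) ∘ t) d)
⊩-subst s t (app d e) = app (⊩-subst s t d) (⊩-subst s t e)
⊩-subst s t (pair d e) = pair (⊩-subst s t d) (⊩-subst s t e)
⊩-subst s t (π₁ d) = π₁ (⊩-subst s t d)
⊩-subst s t (π₂ d) = π₂ (⊩-subst s t d)
⊩-subst s t skip = skip
⊩-subst s t (letskip d e) = letskip (⊩-subst s t d) (⊩-subst s t e)
⊩-subst s t tt = tt
⊩-subst s t ff = ff
⊩-subst s t (ite d e f) = ite (⊩-subst s t d) (⊩-subst s t e) (⊩-subst s t f)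
⊩-subst s t and = and
⊩-subst s t xor = xor
⊩-subst s t neg = neg
⊩-subst s t (inj₁ d) = inj₁ (⊩-subst s t d)
⊩-subst s t (inj₂ d) = inj₂ (⊩-subst s t d)
⊩-subst s t (match d e f) =
  match (⊩-subst s t d)
        (⊩-subst (⊩-lifts s) (⊩-rename (λ _ → refl) ∘ t) e)
        (⊩-subst (⊩-lifts s) (⊩-rename (λ _ → refl) ∘ t) f)
⊩-subst s t split = split
⊩-subst s t (Y d) = Y (⊩-subst s t d)
⊩-subst s t Err = Err
⊩-subst s t (fold d) = fold (⊩-subst s t d)
⊩-subst s t (unfold d) = unfold (⊩-subst s t d)

⊩-[] : {M : Term (suc k)} {N : Term k} → Δ ∣ A ∷ Γ ⊩ M ∶ B → Δ ∣ Γ ⊩ N ∶ A → Δ ∣ Γ ⊩ M [ N ] ∶ B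
⊩-[] {Δ = Δ} {A} {Γ} {N = N} d e = ⊩-subst s fvar d
  where
  s : ∀ i → Δ ∣ Γ ⊩ single N i ∶ lookup (A ∷ Γ) i
  s zero    = e
  s (suc i) = bvar refl

⊩-weaken : {M : Term k} → Δ ⊆ Δ′ → Δ ∣ Γ ⊩ M ∶ A → Δ′ ∣ Γ ⊩ M ∶ A
⊩-weaken {M = M} s d =
  -- Substituting each variable for itself enlarges the context without another induction.
  ≡.subst (_ ∣ _ ⊩_∶ _) (subst-id (λ _ → refl) (λ _ → refl) M) (⊩-subst (λ _ → bvar refl) (fvar ∘ s) d)

-- At a sum type the derivation may end in a detour, a `fold` followed by an `unfold`, which returns
-- to the same type. Removing such detours leads to the introduction rule.
⊩-inj₁⁻ : {M : Term k} → Δ ∣ Γ ⊩ inj₁ M ∶ A ⊕ B → Δ ∣ Γ ⊩ M ∶ A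
⊩-inj₁⁻ (inj₁ d)          = d
⊩-inj₁⁻ (unfold (fold d)) = ⊩-inj₁⁻ d

⊩-inj₂⁻ : {M : Term k} → Δ ∣ Γ ⊩ inj₂ M ∶ A ⊕ B → Δ ∣ Γ ⊩ M ∶ B
⊩-inj₂⁻ (inj₂ d)          = d
⊩-inj₂⁻ (unfold (fold d)) = ⊩-inj₂⁻ d

-- `fold` and `unfold` conclude only list and sum types, so abstractions and pairs are inverted by
-- matching at arrow and product types. The injections are the case where detours can occur.
⊩-↦ : {R R′ : Term k} → R ↦ R′ → Δ ∣ Γ ⊩ R ∶ A → Δ ∣ Γ ⊩ R′ ∶ A
⊩-↦ r              (fold d)        = fold (⊩-↦ r d)
⊩-↦ r              (unfold d)      = unfold (⊩-↦ r d)
⊩-↦ (β M N)        (app (lam d) e) = ⊩-[] d e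
⊩-↦ (π₁ M N)       (π₁ (pair d e)) = d
⊩-↦ (π₂ M N)       (π₂ (pair d e)) = e
⊩-↦ (letskip M)    (letskip d e)   = e
⊩-↦ (split M)      (app split d)   = unfold d
⊩-↦ (match₁ P M N) (match d e f)   = ⊩-[] e (⊩-inj₁⁻ d)
⊩-↦ (match₂ P M N) (match d e f)   = ⊩-[] f (⊩-inj₂⁻ d)
⊩-↦ (Y M)          (Y d)           = app d (Y d)

-- Typing bounds the free names by `Δ`. This is what makes the surroundings of a redex insensitive
-- to newly linked names.
subst-agree : {σ : Fin k → Term l} {ν ν′ : Name → Term l} {M : Term k} →
              (∀ {x} → x ∈ Δ → ν x ≡ ν′ x) → Δ ∣ Γ ⊩ M ∶ A → subst σ ν M ≡ subst σ ν′ M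
subst-agree h (bvar _) = refl
subst-agree h (fvar x∈Δ) = h x∈Δ
subst-agree h (lam d) = cong lam (subst-agree (cong weaken ∘ h) d)
subst-agree h (app d e) = cong₂ app (subst-agree h d) (subst-agree h e)
subst-agree h (pair d e) = cong₂ pair (subst-agree h d) (subst-agree h e)
subst-agree h (π₁ d) = cong π₁ (subst-agree h d)
subst-agree h (π₂ d) = cong π₂ (subst-agree h d)
subst-agree h skip = refl
subst-agree h (letskip d e) = cong₂ letskip (subst-agree h d) (subst-agree h e)
subst-agree h tt = refl
subst-agree h ff = refl
subst-agree h (ite d e f) = cong₃ ite (subst-agree h d) (subst-agree h e) (subst-agree h f)
subst-agree h and = refl
subst-agree h xor = refl
subst-agree h neg = refl
subst-agree h (inj₁ d) = cong inj₁ (subst-agree h d)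
subst-agree h (inj₂ d) = cong inj₂ (subst-agree h d)
subst-agree h (match d e f) =
  cong₃ match (subst-agree h d) (subst-agree (cong weaken ∘ h) e) (subst-agree (cong weaken ∘ h) f)
subst-agree h split = refl
subst-agree h (Y d) = cong Y (subst-agree h d)
subst-agree h Err = refl
subst-agree h (fold d) = subst-agree h d
subst-agree h (unfold d) = subst-agree h d

-- Closing terms by the values of their linked names

-- The substitution inside `readback`, for terms with bound indices too. At `Term 0` and the final
-- valuation, `close` unfolds to `readback`, so the two are interchanged without mention.
value : Linking → Valuation → Name → Term k
value L v x = maybe′ (bool ∘ v) (fvar x) (linked L x)

close : Linking → Valuation → Term k → Term k
close L v = substNames (value L v)

weaken-value : (L : Linking) (v : Valuation) (x : Name) → weaken (value {k} L v x) ≡ value L v x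
weaken-value L v x with linked L x
... | just i  = rename-bool suc (v i)
... | nothing = refl

-- Booleans and names contain no indices, so weakening does not change them, and closing commutes
-- with binders as it does with other layers.
close-under : (L : Linking) (v : Valuation) (M : Term (suc k)) →
              subst (lifts bvar) (weaken ∘ value L v) M ≡ close L v M
close-under L v = subst-cong (lifts-bvar (λ _ → refl)) (weaken-value L v)

closeᶜ : Linking → Valuation → Context k l → Context k l
closeᶜ L v □ = □
closeᶜ L v (lam E) = lam (closeᶜ L v E)
closeᶜ L v (appˡ E N) = appˡ (closeᶜ L v E) (close L v N)
closeᶜ L v (appʳ M E) = appʳ (close L v M) (closeᶜ L v E)
closeᶜ L v (pairˡ E N) = pairˡ (closeᶜ L v E) (close L v N)
closeᶜ L v (pairʳ M E) = pairʳ (close L v M) (closeᶜ L v E)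
closeᶜ L v (π₁ E) = π₁ (closeᶜ L v E)
closeᶜ L v (π₂ E) = π₂ (closeᶜ L v E)
closeᶜ L v (letskipˡ E N) = letskipˡ (closeᶜ L v E) (close L v N)
closeᶜ L v (letskipʳ M E) = letskipʳ (close L v M) (closeᶜ L v E)
closeᶜ L v (iteᶜ E M N) = iteᶜ (closeᶜ L v E) (close L v M) (close L v N)
closeᶜ L v (iteᵗ P E N) = iteᵗ (close L v P) (closeᶜ L v E) (close L v N)
closeᶜ L v (iteᵉ P M E) = iteᵉ (close L v P) (close L v M) (closeᶜ L v E)
closeᶜ L v (inj₁ E) = inj₁ (closeᶜ L v E)
closeᶜ L v (inj₂ E) = inj₂ (closeᶜ L v E)
closeᶜ L v (matchᶜ E M N) = matchᶜ (closeᶜ L v E) (close L v M) (close L v N)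
closeᶜ L v (matchˡ P E N) = matchˡ (close L v P) (closeᶜ L v E) (close L v N)
closeᶜ L v (matchʳ P M E) = matchʳ (close L v P) (close L v M) (closeᶜ L v E)
closeᶜ L v (Y E) = Y (closeᶜ L v E)

close-⟦⟧ : (L : Linking) (v : Valuation) (E : Context k l) (R : Term l) →
           close L v (E ⟦ R ⟧) ≡ closeᶜ L v E ⟦ close L v R ⟧
close-⟦⟧ L v □ R = refl
close-⟦⟧ L v (lam E) R = cong lam (trans (close-under L v (E ⟦ R ⟧)) (close-⟦⟧ L v E R))
close-⟦⟧ L v (appˡ E N) R = cong₂ app (close-⟦⟧ L v E R) refl
close-⟦⟧ L v (appʳ M E) R = cong₂ app refl (close-⟦⟧ L v E R)
close-⟦⟧ L v (pairˡ E N) R = cong₂ pair (close-⟦⟧ L v E R) refl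
close-⟦⟧ L v (pairʳ M E) R = cong₂ pair refl (close-⟦⟧ L v E R)
close-⟦⟧ L v (π₁ E) R = cong π₁ (close-⟦⟧ L v E R)
close-⟦⟧ L v (π₂ E) R = cong π₂ (close-⟦⟧ L v E R)
close-⟦⟧ L v (letskipˡ E N) R = cong₂ letskip (close-⟦⟧ L v E R) refl
close-⟦⟧ L v (letskipʳ M E) R = cong₂ letskip refl (close-⟦⟧ L v E R)
close-⟦⟧ L v (iteᶜ E M N) R = cong₃ ite (close-⟦⟧ L v E R) refl refl
close-⟦⟧ L v (iteᵗ P E N) R = cong₃ ite refl (close-⟦⟧ L v E R) refl
close-⟦⟧ L v (iteᵉ P M E) R = cong₃ ite refl refl (close-⟦⟧ L v E R)
close-⟦⟧ L v (inj₁ E) R = cong inj₁ (close-⟦⟧ L v E R)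
close-⟦⟧ L v (inj₂ E) R = cong inj₂ (close-⟦⟧ L v E R)
close-⟦⟧ L v (matchᶜ E M N) R = cong₃ match (close-⟦⟧ L v E R) (close-under L v M) (close-under L v N)
close-⟦⟧ L v (matchˡ P E N) R =
  cong₃ match refl (trans (close-under L v (E ⟦ R ⟧)) (close-⟦⟧ L v E R)) (close-under L v N)
close-⟦⟧ L v (matchʳ P M E) R =
  cong₃ match refl (close-under L v M) (trans (close-under L v (E ⟦ R ⟧)) (close-⟦⟧ L v E R))
close-⟦⟧ L v (Y E) R = cong Y (close-⟦⟧ L v E R)

↦-subst : {σ : Fin k → Term l} {ν : Name → Term l} {R R′ : Term k} →
          R ↦ R′ → subst σ ν R ↦ subst σ ν R′
↦-subst {σ = σ} {ν} (β M N) rewrite subst-[] σ ν M N = β _ _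
↦-subst (π₁ M N) = π₁ _ _
↦-subst (π₂ M N) = π₂ _ _
↦-subst (letskip M) = letskip _
↦-subst (split M) = split _
↦-subst {σ = σ} {ν} (match₁ P M N) rewrite subst-[] σ ν M P = match₁ _ _ _
↦-subst {σ = σ} {ν} (match₂ P M N) rewrite subst-[] σ ν N P = match₂ _ _ _
↦-subst (Y M) = Y _

-- Decomposition of typed terms along contexts

Agree : List Name → Linking → Valuation → Linking → Valuation → Set
Agree Δ L v L′ v′ = ∀ {k x} → x ∈ Δ → value {k} L v x ≡ value L′ v′ x

-- Everything that a machine step needs to know about its context, collected in one traversal.
-- `plug` allows a larger list of names, since the new content of the hole may use names just
-- linked.
record Decomposition (Δ : List Name) {k l} (Γ : Vec Type k) (E : Context k l) (R : Term l) (A : Type) :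
       Set where
  field
    {holeContext} : Vec Type l
    {holeType}    : Type
    hole   : Δ ∣ holeContext ⊩ R ∶ holeType
    plug   : ∀ {Δ′ R′} → Δ ⊆ Δ′ → Δ′ ∣ holeContext ⊩ R′ ∶ holeType → Δ′ ∣ Γ ⊩ E ⟦ R′ ⟧ ∶ A
    agreeᶜ : ∀ {L v L′ v′} → Agree Δ L v L′ v′ → closeᶜ L v E ≡ closeᶜ L′ v′ E

open Decomposition

decompose-fold : {E : Context k l} {R : Term l} →
                 Decomposition Δ Γ E R (𝟙 ⊕ (A ⊗ [ A ]ᵗ)) → Decomposition Δ Γ E R [ A ]ᵗ
decompose-fold r = record { hole = hole r ; plug = λ s d → fold (plug r s d) ; agreeᶜ = agreeᶜ r }

decompose-unfold : {E : Context k l} {R : Term l} →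
                   Decomposition Δ Γ E R [ A ]ᵗ → Decomposition Δ Γ E R (𝟙 ⊕ (A ⊗ [ A ]ᵗ))
decompose-unfold r = record { hole = hole r ; plug = λ s d → unfold (plug r s d) ; agreeᶜ = agreeᶜ r }

-- `fold` and `unfold` leave the term as it is, so each layer has two clauses in which the
-- derivation shrinks and the context does not.
decompose : (E : Context k l) {R : Term l} → Δ ∣ Γ ⊩ E ⟦ R ⟧ ∶ A → Decomposition Δ Γ E R A
decompose □ d = record { hole = d ; plug = λ _ d′ → d′ ; agreeᶜ = λ _ → refl }
decompose (lam E) (lam d) = record
  { hole   = hole r
  ; plug   = λ s d′ → lam (plug r s d′)
  ; agreeᶜ = λ h → cong lam (agreeᶜ r h)
  } where r = decompose E d
decompose (lam E) (fold d) = decompose-fold (decompose (lam E) d)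
decompose (lam E) (unfold d) = decompose-unfold (decompose (lam E) d)
decompose (appˡ E N) (app d e) = record
  { hole   = hole r
  ; plug   = λ s d′ → app (plug r s d′) (⊩-weaken s e)
  ; agreeᶜ = λ h → cong₂ appˡ (agreeᶜ r h) (subst-agree h e)
  } where r = decompose E d
decompose (appˡ E N) (fold d) = decompose-fold (decompose (appˡ E N) d)
decompose (appˡ E N) (unfold d) = decompose-unfold (decompose (appˡ E N) d)
decompose (appʳ M E) (app d e) = record
  { hole   = hole r
  ; plug   = λ s d′ → app (⊩-weaken s d) (plug r s d′)
  ; agreeᶜ = λ h → cong₂ appʳ (subst-agree h d) (agreeᶜ r h)
  } where r = decompose E e
decompose (appʳ M E) (fold d) = decompose-fold (decompose (appʳ M E) d)
decompose (appʳ M E) (unfold d) = decompose-unfold (decompose (appʳ M E) d)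
decompose (pairˡ E N) (pair d e) = record
  { hole   = hole r
  ; plug   = λ s d′ → pair (plug r s d′) (⊩-weaken s e)
  ; agreeᶜ = λ h → cong₂ pairˡ (agreeᶜ r h) (subst-agree h e)
  } where r = decompose E d
decompose (pairˡ E N) (fold d) = decompose-fold (decompose (pairˡ E N) d)
decompose (pairˡ E N) (unfold d) = decompose-unfold (decompose (pairˡ E N) d)
decompose (pairʳ M E) (pair d e) = record
  { hole   = hole r
  ; plug   = λ s d′ → pair (⊩-weaken s d) (plug r s d′)
  ; agreeᶜ = λ h → cong₂ pairʳ (subst-agree h d) (agreeᶜ r h)
  } where r = decompose E e
decompose (pairʳ M E) (fold d) = decompose-fold (decompose (pairʳ M E) d)
decompose (pairʳ M E) (unfold d) = decompose-unfold (decompose (pairʳ M E) d)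
decompose (π₁ E) (π₁ d) = record
  { hole   = hole r
  ; plug   = λ s d′ → π₁ (plug r s d′)
  ; agreeᶜ = λ h → cong π₁ (agreeᶜ r h)
  } where r = decompose E d
decompose (π₁ E) (fold d) = decompose-fold (decompose (π₁ E) d)
decompose (π₁ E) (unfold d) = decompose-unfold (decompose (π₁ E) d)
decompose (π₂ E) (π₂ d) = record
  { hole   = hole r
  ; plug   = λ s d′ → π₂ (plug r s d′)
  ; agreeᶜ = λ h → cong π₂ (agreeᶜ r h)
  } where r = decompose E d
decompose (π₂ E) (fold d) = decompose-fold (decompose (π₂ E) d)
decompose (π₂ E) (unfold d) = decompose-unfold (decompose (π₂ E) d)
decompose (letskipˡ E N) (letskip d e) = record
  { hole   = hole r
  ; plug   = λ s d′ → letskip (plug r s d′) (⊩-weaken s e)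
  ; agreeᶜ = λ h → cong₂ letskipˡ (agreeᶜ r h) (subst-agree h e)
  } where r = decompose E d
decompose (letskipˡ E N) (fold d) = decompose-fold (decompose (letskipˡ E N) d)
decompose (letskipˡ E N) (unfold d) = decompose-unfold (decompose (letskipˡ E N) d)
decompose (letskipʳ M E) (letskip d e) = record
  { hole   = hole r
  ; plug   = λ s d′ → letskip (⊩-weaken s d) (plug r s d′)
  ; agreeᶜ = λ h → cong₂ letskipʳ (subst-agree h d) (agreeᶜ r h)
  } where r = decompose E e
decompose (letskipʳ M E) (fold d) = decompose-fold (decompose (letskipʳ M E) d)
decompose (letskipʳ M E) (unfold d) = decompose-unfold (decompose (letskipʳ M E) d)
decompose (iteᶜ E M N) (ite d e f) = record
  { hole   = hole r
  ; plug   = λ s d′ → ite (plug r s d′) (⊩-weaken s e) (⊩-weaken s f)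
  ; agreeᶜ = λ h → cong₃ iteᶜ (agreeᶜ r h) (subst-agree h e) (subst-agree h f)
  } where r = decompose E d
decompose (iteᶜ E M N) (fold d) = decompose-fold (decompose (iteᶜ E M N) d)
decompose (iteᶜ E M N) (unfold d) = decompose-unfold (decompose (iteᶜ E M N) d)
decompose (iteᵗ P E N) (ite d e f) = record
  { hole   = hole r
  ; plug   = λ s d′ → ite (⊩-weaken s d) (plug r s d′) (⊩-weaken s f)
  ; agreeᶜ = λ h → cong₃ iteᵗ (subst-agree h d) (agreeᶜ r h) (subst-agree h f)
  } where r = decompose E e
decompose (iteᵗ P E N) (fold d) = decompose-fold (decompose (iteᵗ P E N) d)
decompose (iteᵗ P E N) (unfold d) = decompose-unfold (decompose (iteᵗ P E N) d)
decompose (iteᵉ P M E) (ite d e f) = record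
  { hole   = hole r
  ; plug   = λ s d′ → ite (⊩-weaken s d) (⊩-weaken s e) (plug r s d′)
  ; agreeᶜ = λ h → cong₃ iteᵉ (subst-agree h d) (subst-agree h e) (agreeᶜ r h)
  } where r = decompose E f
decompose (iteᵉ P M E) (fold d) = decompose-fold (decompose (iteᵉ P M E) d)
decompose (iteᵉ P M E) (unfold d) = decompose-unfold (decompose (iteᵉ P M E) d)
decompose (inj₁ E) (inj₁ d) = record
  { hole   = hole r
  ; plug   = λ s d′ → inj₁ (plug r s d′)
  ; agreeᶜ = λ h → cong inj₁ (agreeᶜ r h)
  } where r = decompose E d
decompose (inj₁ E) (fold d) = decompose-fold (decompose (inj₁ E) d)
decompose (inj₁ E) (unfold d) = decompose-unfold (decompose (inj₁ E) d)
decompose (inj₂ E) (inj₂ d) = record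
  { hole   = hole r
  ; plug   = λ s d′ → inj₂ (plug r s d′)
  ; agreeᶜ = λ h → cong inj₂ (agreeᶜ r h)
  } where r = decompose E d
decompose (inj₂ E) (fold d) = decompose-fold (decompose (inj₂ E) d)
decompose (inj₂ E) (unfold d) = decompose-unfold (decompose (inj₂ E) d)
decompose (matchᶜ E M N) (match d e f) = record
  { hole   = hole r
  ; plug   = λ s d′ → match (plug r s d′) (⊩-weaken s e) (⊩-weaken s f)
  ; agreeᶜ = λ h → cong₃ matchᶜ (agreeᶜ r h) (subst-agree h e) (subst-agree h f)
  } where r = decompose E d
decompose (matchᶜ E M N) (fold d) = decompose-fold (decompose (matchᶜ E M N) d)
decompose (matchᶜ E M N) (unfold d) = decompose-unfold (decompose (matchᶜ E M N) d)
decompose (matchˡ P E N) (match d e f) = record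
  { hole   = hole r
  ; plug   = λ s d′ → match (⊩-weaken s d) (plug r s d′) (⊩-weaken s f)
  ; agreeᶜ = λ h → cong₃ matchˡ (subst-agree h d) (agreeᶜ r h) (subst-agree h f)
  } where r = decompose E e
decompose (matchˡ P E N) (fold d) = decompose-fold (decompose (matchˡ P E N) d)
decompose (matchˡ P E N) (unfold d) = decompose-unfold (decompose (matchˡ P E N) d)
decompose (matchʳ P M E) (match d e f) = record
  { hole   = hole r
  ; plug   = λ s d′ → match (⊩-weaken s d) (⊩-weaken s e) (plug r s d′)
  ; agreeᶜ = λ h → cong₃ matchʳ (subst-agree h d) (subst-agree h e) (agreeᶜ r h)
  } where r = decompose E f
decompose (matchʳ P M E) (fold d) = decompose-fold (decompose (matchʳ P M E) d)
decompose (matchʳ P M E) (unfold d) = decompose-unfold (decompose (matchʳ P M E) d)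
decompose (Y E) (Y d) = record
  { hole   = hole r
  ; plug   = λ s d′ → Y (plug r s d′)
  ; agreeᶜ = λ h → cong Y (agreeᶜ r h)
  } where r = decompose E d
decompose (Y E) (fold d) = decompose-fold (decompose (Y E) d)
decompose (Y E) (unfold d) = decompose-unfold (decompose (Y E) d)

-- Circuits

≡ᵇ-refl : (x : ℕ) → (x ≡ᵇ x) ≡ true
≡ᵇ-refl x = dec-true (x ≟ x) refl

≢⇒≡ᵇ : {x y : ℕ} → x ≢ y → (x ≡ᵇ y) ≡ false
≢⇒≡ᵇ {x} {y} = dec-false (x ≟ y)

conjunction : List Control → Valuation → Bool
conjunction cs v = List.foldr (λ (b , j) r → ((v j ⊻ b) ⊻ true) ∧ r) true cs

conjunction-cong : {v v′ : Valuation} {cs : List Control} →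
                   All (λ j → v j ≡ v′ j) (List.map proj₂ cs) → conjunction cs v ≡ conjunction cs v′
conjunction-cong {cs = []}           []       = refl
conjunction-cong {cs = (b , j) ∷ cs} (h ∷ hs) =
  cong₂ _∧_ (cong (λ a → (a ⊻ b) ⊻ true) h) (conjunction-cong hs)

flip : Gate → Valuation → Wire → Bool
flip G v w = if w ≡ᵇ target G then conjunction (controls G) v else false

-- Every conjunction is evaluated in the same valuation `v`, the one before any of the gates is
-- executed. `Acts` is the condition under which this is what execution does.
flips : List Gate → Valuation → Wire → Bool
flips []       v w = false
flips (G ∷ Gs) v w = flip G v w ⊻ flips Gs v w

-- When all gates of a list write inside `Ws` and read outside it, none of them disturbs the
-- controls of another.
record Acts (Ws : List Wire) (G : Gate) : Set where
  constructor acts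
  field
    on       : target G ∈ Ws
    controls∉ : All (_∉ Ws) (List.map proj₂ (controls G))

private variable
  Ws    : List Wire
  Gs Hs : List Gate

execGate-≢ : (v : Valuation) (G : Gate) {w : Wire} → w ≢ target G → execGate G v w ≡ v w
execGate-≢ v G w≢ rewrite ≢⇒≡ᵇ w≢ = refl

exec-∉ : (v : Valuation) {w : Wire} → All (Acts Ws) Gs → w ∉ Ws → List.foldr execGate v Gs w ≡ v w
exec-∉ v []                    w∉ = refl
exec-∉ {Gs = G ∷ Gs} v (a ∷ as) w∉ =
  trans (execGate-≢ (List.foldr execGate v Gs) G (λ { refl → w∉ (Acts.on a) })) (exec-∉ v as w∉)

-- The head of the list is executed last, but by `exec-∉` its controls still have their values in
-- `v`. Each gate thus contributes one xor summand.
exec-flips : (v : Valuation) (w : Wire) → All (Acts Ws) Gs →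
             List.foldr execGate v Gs w ≡ v w ⊻ flips Gs v w
exec-flips v w [] = sym (xor-identityʳ (v w))
exec-flips {Gs = G ∷ Gs} v w (acts _ cs∉ ∷ as)
  rewrite conjunction-cong {cs = controls G} (All.map (exec-∉ v as) cs∉)
        | exec-flips v w as
  with w ≡ᵇ target G
... | false = refl
... | true  = trans (xor-assoc (v w) _ _) (cong (v w ⊻_) (xor-comm (flips Gs v w) _))

xor-left-comm : (a b c : Bool) → a ⊻ (b ⊻ c) ≡ b ⊻ (a ⊻ c)
xor-left-comm a b c =
  trans (sym (xor-assoc a b c)) (trans (cong (_⊻ c) (xor-comm a b)) (xor-assoc b a c))

-- The summands refer to one valuation, and xor is commutative. This accounts for the free order in
-- which the gates of a conditional may be added.
flips-↭ : (v : Valuation) (w : Wire) → Gs ↭ Hs → flips Gs v w ≡ flips Hs v w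
flips-↭ v w refl            = refl
flips-↭ v w (prep G p)      = cong (flip G v w ⊻_) (flips-↭ v w p)
flips-↭ v w (swap G H p)    =
  trans (xor-left-comm (flip G v w) (flip H v w) _)
        (cong (λ b → flip H v w ⊻ (flip G v w ⊻ b)) (flips-↭ v w p))
flips-↭ v w (_↭_.trans p q) = trans (flips-↭ v w p) (flips-↭ v w q)

flips-≢ : (v : Valuation) (G : Gate) (Gs : List Gate) {w : Wire} →
          w ≢ target G → flips (G ∷ Gs) v w ≡ flips Gs v w
flips-≢ v G Gs w≢ rewrite ≢⇒≡ᵇ w≢ = refl

flips-∉ : (v : Valuation) {w : Wire} → All (Acts Ws) Gs → w ∉ Ws → flips Gs v w ≡ false
flips-∉ v []                     w∉ = refl
flips-∉ {Gs = G ∷ Gs} v (a ∷ as) w∉ =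
  trans (flips-≢ v G Gs (λ { refl → w∉ (Acts.on a) })) (flips-∉ v as w∉)

initial-∉ : (I : Vec Wire n) (u : Vec Bool n) {w : Wire} → w ∉ Vec.toList I → initial I u w ≡ false
initial-∉ []      []      w∉ = refl
initial-∉ (i ∷ I) (b ∷ u) w∉ rewrite ≢⇒≡ᵇ (w∉ ∘ here) = initial-∉ I u (w∉ ∘ there)

-- A wire that is no input starts at the default `false`, and only a gate targeting it could change
-- it. A new wire therefore holds exactly what its own gates xor into it.
finalValuation-∉ : (I : Vec Wire n) (C : List Gate) (u : Vec Bool n) {w : Wire} →
                   w ∉ Vec.toList I → w ∉ wires C → finalValuation I C u w ≡ false
finalValuation-∉ I []      u w∉I w∉C = initial-∉ I u w∉I
finalValuation-∉ I (G ∷ C) u w∉I w∉C =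
  trans (execGate-≢ (finalValuation I C u) G (w∉C ∘ here))
        (finalValuation-∉ I C u w∉I (w∉C ∘ there ∘ ∈-++⁺ʳ (List.map proj₂ (controls G))))

-- Linkings

private variable
  L Us : Linking
  C    : List Gate

linked-∈ : {p : Name} {i : Wire} → Listᵁ.Unique (domain L) → (p , i) ∈ L → linked L p ≡ just i
linked-∈ {p = p} (_ ∷ _) (here refl) rewrite ≡ᵇ-refl p = refl
linked-∈ (x∉ ∷ un) (there p∈L) rewrite ≢⇒≡ᵇ (All.lookup x∉ (∈-map⁺ proj₁ p∈L) ∘ sym) = linked-∈ un p∈L

linked-++ʳ : (Us : Linking) {x : Name} → x ∉ domain Us → linked (Us ++ L) x ≡ linked L x
linked-++ʳ []       x∉ = refl
linked-++ʳ (u ∷ Us) x∉ rewrite ≢⇒≡ᵇ (x∉ ∘ here) = linked-++ʳ Us (x∉ ∘ there)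

fresh-names : All (Fresh n C L) Us → {x : Name} → x ∈ domain L → x ∉ domain Us
fresh-names new x∈L x∈Us with _ , u∈Us , refl ← ∈-map⁻ proj₁ x∈Us = Fresh.p∉L (All.lookup new u∈Us) x∈L

fresh-wires : All (Fresh n C L) Us → {i : Wire} → i ∈ range L → i ∉ range Us
fresh-wires new i∈L i∈Us with _ , u∈Us , refl ← ∈-map⁻ proj₂ i∈Us = Fresh.i∉L (All.lookup new u∈Us) i∈L

unique-++ : All (Fresh n C L) Us → Listᵁ.Unique (domain Us) → Listᵁ.Unique (domain L) →
            Listᵁ.Unique (domain (Us ++ L))
unique-++ {L = L} {Us} new unU unL rewrite map-++ proj₁ Us L =
  Listᵁ.++⁺ unU unL (λ (x∈Us , x∈L) → fresh-names new x∈L x∈Us)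

domain-++ʳ : (Us : Linking) → domain L ⊆ domain (Us ++ L)
domain-++ʳ {L} Us rewrite map-++ proj₁ Us L = ∈-++⁺ʳ (domain Us)

value-∈ : {v : Valuation} {p : Name} {i : Wire} → Listᵁ.Unique (domain L) → (p , i) ∈ L →
          value {k} L v p ≡ bool (v i)
value-∈ un p∈L rewrite linked-∈ un p∈L = refl

cnotNew-acts : {u : Binding} → All (Fresh n C L) Us → u ∈ Us → (new : Fresh n C L u) →
               (cs : List (LinkedControl L)) → Acts (range Us) (cnotNew new cs)
cnotNew-acts news u∈Us new cs = acts (∈-range u∈Us) (All.tabulate (fresh-wires news ∘ controls⊆range cs))

module _ {n : ℕ} (u : Vec Bool n) where

  final : List Gate → Valuation
  final C = finalValuation (inputs n) C u

  final-++ : (Gs C : List Gate) (w : Wire) → final (Gs ++ C) w ≡ List.foldr execGate (final C) Gs w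
  final-++ Gs C w = cong (λ v → v w) (foldr-++ execGate (initial (inputs n) u) Gs C)

  -- Two causes: new bindings do not shadow old names, and the added gates write on new wires only.
  agree-++ : All (Fresh n C L) Us → All (Acts (range Us)) Gs → Listᵁ.Unique (domain L) →
             Agree (domain L) L (final C) (Us ++ L) (final (Gs ++ C))
  agree-++ {C} {L} {Us} {Gs} new as un {x = x} x∈L
    with (_ , i) , p∈L , refl ← ∈-map⁻ proj₁ x∈L
    rewrite linked-++ʳ {L = L} Us (fresh-names new x∈L) | linked-∈ un p∈L
    = cong bool (sym (trans (final-++ Gs C i) (exec-∉ (final C) as (fresh-wires new (∈-range p∈L)))))

  -- The wire holds `false` before the added gates, by `finalValuation-∉`, and `false` is the unit
  -- of xor.
  value-new : {q : Name} {i : Wire} →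
              All (Fresh n C L) Us → All (Acts (range Us)) Gs →
              Listᵁ.Unique (domain Us) → Listᵁ.Unique (domain L) → (q , i) ∈ Us →
              value {k} (Us ++ L) (final (Gs ++ C)) q ≡ bool (flips Gs (final C) i)
  value-new {C} {L} {Us} {Gs} {i = i} new as unU unL q∈Us =
    trans (value-∈ (unique-++ new unU unL) (∈-++⁺ˡ q∈Us))
      (cong bool (trans (final-++ Gs C i) (trans (exec-flips (final C) i as)
        (cong (_⊻ flips Gs (final C) i) (finalValuation-∉ (inputs n) C u (Fresh.i∉I fr) (Fresh.i∉C fr))))))
    where fr = All.lookup new q∈Us

-- First-order extensions

SameLength : {X : Set} → List X → List X → Set
SameLength = Pointwise (λ _ _ → ⊤)

leaves-SameShape : {X : Set} {V W : Tree X} → SameShape V W → SameLength (leaves V) (leaves W)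
leaves-SameShape leaf              = tt ∷ []
leaves-SameShape (pair s t)        = Pointwise.++⁺ (leaves-SameShape s) (leaves-SameShape t)
leaves-SameShape (list [])         = []
leaves-SameShape (list (s ∷ ss))   = Pointwise.++⁺ (leaves-SameShape s) (leaves-SameShape (list ss))

-- The machine relates `V` to both `W` and `U`; selecting the else branch requires `W` and `U` to be
-- related.
SameShape-euclidean : {X : Set} {V W U : Tree X} → SameShape V W → SameShape V U → SameShape W U
SameShape-euclideanᴸ : {X : Set} {Vs Ws Us : List (Tree X)} →
  Pointwise SameShape Vs Ws → Pointwise SameShape Vs Us → Pointwise SameShape Ws Us
SameShape-euclidean leaf        leaf          = leaf
SameShape-euclidean (pair s t)  (pair s′ t′)  = pair (SameShape-euclidean s s′) (SameShape-euclidean t t′)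
SameShape-euclidean (list ss)   (list ss′)    = list (SameShape-euclideanᴸ ss ss′)
SameShape-euclideanᴸ []       []         = []
SameShape-euclideanᴸ (s ∷ ss) (s′ ∷ ss′) = SameShape-euclidean s s′ ∷ SameShape-euclideanᴸ ss ss′

⊩-skip : Δ ∣ Γ ⊩ skip ∶ A → Δ′ ∣ Γ ⊩ skip ∶ A
⊩-skip skip       = skip
⊩-skip (fold d)   = fold (⊩-skip d)
⊩-skip (unfold d) = unfold (⊩-skip d)

-- Each leaf is a name, and each name has type `bit`, so a derivation for one tree can be copied,
-- with its uses of `fold` and `unfold`, to another tree of the same shape.
⊩-SameShape : {V U : Tree Binding} {Γ : Vec Type k} → SameShape V U → All (λ x → proj₁ x ∈ Δ′) (leaves U) →
              Δ ∣ Γ ⊩ ⌜ V ⌝ ∶ A → Δ′ ∣ Γ ⊩ ⌜ U ⌝ ∶ A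
⊩-SameShape leaf (a ∷ []) (fvar _) = fvar a
⊩-SameShape s@leaf as (fold d)   = fold (⊩-SameShape s as d)
⊩-SameShape s@leaf as (unfold d) = unfold (⊩-SameShape s as d)
⊩-SameShape (pair {W = W} s t) as (pair d e) =
  pair (⊩-SameShape s (All.++⁻ˡ (leaves W) as) d) (⊩-SameShape t (All.++⁻ʳ (leaves W) as) e)
⊩-SameShape (pair s t) as (fold d)   = fold (⊩-SameShape (pair s t) as d)
⊩-SameShape (pair s t) as (unfold d) = unfold (⊩-SameShape (pair s t) as d)
⊩-SameShape (list []) as (inj₁ d) = inj₁ (⊩-skip d)
-- Under the injection a nonempty list is the pair of its head and its tail, both as a term and in
-- its leaves.
⊩-SameShape (list (s ∷ ss)) as (inj₂ d) = inj₂ (⊩-SameShape (pair s (list ss)) as d)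
⊩-SameShape (list []) as (fold d) = fold (⊩-SameShape (list []) as d)
⊩-SameShape (list []) as (unfold d) = unfold (⊩-SameShape (list []) as d)
⊩-SameShape (list (s ∷ ss)) as (fold d) = fold (⊩-SameShape (list (s ∷ ss)) as d)
⊩-SameShape (list (s ∷ ss)) as (unfold d) = unfold (⊩-SameShape (list (s ∷ ss)) as d)

pointwise-++⁻ : {X : Set} {R : X → X → Set} {as bs xs ys : List X} → SameLength as bs →
                Pointwise R (as ++ xs) (bs ++ ys) → Pointwise R as bs × Pointwise R xs ys
pointwise-++⁻ []       rs       = [] , rs
pointwise-++⁻ (_ ∷ ps) (r ∷ rs) with ss , ts ← pointwise-++⁻ ps rs = r ∷ ss , ts

module _ (k : ℕ) (L L′ : Linking) (v v′ : Valuation) where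

  SameValue : Binding → Binding → Set
  SameValue x y = value {k} L v (proj₁ x) ≡ value L′ v′ (proj₁ y)

  close-SameShape : {V U : Tree Binding} → SameShape V U →
    Pointwise SameValue (leaves V) (leaves U) → close {k} L v ⌜ V ⌝ ≡ close L′ v′ ⌜ U ⌝
  close-SameShapeᴸ : {Vs Us : List (Tree Binding)} → Pointwise SameShape Vs Us →
    Pointwise SameValue (leavesᴸ Vs) (leavesᴸ Us) → close {k} L v ⌜ Vs ⌝ᴸ ≡ close L′ v′ ⌜ Us ⌝ᴸ
  close-SameShape leaf (h ∷ []) = h
  close-SameShape (pair s t) hs with hs₁ , hs₂ ← pointwise-++⁻ (leaves-SameShape s) hs =
    cong₂ pair (close-SameShape s hs₁) (close-SameShape t hs₂)
  close-SameShape (list ss) hs = close-SameShapeᴸ ss hs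
  close-SameShapeᴸ []       hs = refl
  close-SameShapeᴸ (s ∷ ss) hs with hs₁ , hs₂ ← pointwise-++⁻ (leaves-SameShape s) hs =
    cong₂ cons (close-SameShape s hs₁) (close-SameShapeᴸ ss hs₂)

pointwise-map-∈ : {X : Set} {R S : X → X → Set} {xs ys : List X} →
  (∀ {x y} → x ∈ xs → y ∈ ys → R x y → S x y) → Pointwise R xs ys → Pointwise S xs ys
pointwise-map-∈ f []       = []
pointwise-map-∈ f (r ∷ rs) =
  f (here refl) (here refl) r ∷ pointwise-map-∈ (λ x∈ y∈ → f (there x∈) (there y∈)) rs

private variable
  us vs ws : List Binding
  p        : Binding

-- `us` shrinks along the induction while `Us` remains the list of all new bindings: controls have
-- to avoid every new wire, not just those still to come.
ifGates-acts : {n : ℕ} {C : List Gate} {L Us : Linking} → All (Fresh n C L) Us →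
  (p∈L : p ∈ L) (new : All (Fresh n C L) us) (vs∈L : All (_∈ L) vs) (ws∈L : All (_∈ L) ws) →
  us ⊆ Us → All (Acts (range Us)) (ifGates p∈L new vs∈L ws∈L)
ifGates-acts news p∈L []        _          _          us⊆ = []
ifGates-acts news p∈L (_ ∷ _)   []         _          us⊆ = []
ifGates-acts news p∈L (_ ∷ _)   (_ ∷ _)    []         us⊆ = []
ifGates-acts news p∈L (u ∷ new) (v ∷ vs∈L) (w ∷ ws∈L) us⊆ =
  cnotNew-acts news (us⊆ (here refl)) u ((true , _ , p∈L) ∷ (true , _ , v) ∷ []) ∷
  cnotNew-acts news (us⊆ (here refl)) u ((false , _ , p∈L) ∷ (true , _ , w) ∷ []) ∷
  ifGates-acts news p∈L new vs∈L ws∈L (us⊆ ∘ there)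

-- The left side is the form to which `flips` computes for the two gates of one leaf; `∧ true` and
-- `⊻ false` end the two folds. The controls on `b` have opposite polarities, so one of the two
-- conjunctions vanishes.
multiplexer : (b x y : Bool) →
  (((b ⊻ true) ⊻ true) ∧ (((x ⊻ true) ⊻ true) ∧ true)) ⊻
  ((((b ⊻ false) ⊻ true) ∧ (((y ⊻ true) ⊻ true) ∧ true)) ⊻ false) ≡ (if b then x else y)
multiplexer true  true  true  = refl
multiplexer true  true  false = refl
multiplexer true  false true  = refl
multiplexer true  false false = refl
multiplexer false true  true  = refl
multiplexer false true  false = refl
multiplexer false false true  = refl
multiplexer false false false = refl

-- Since the new wires are distinct, each one is changed by its own two gates alone, and these
-- multiplex the corresponding leaves of the branches.
ifGates-flips : {n : ℕ} {C : List Gate} {L : Linking} (v : Valuation) →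
  (p∈L : p ∈ L) (new : All (Fresh n C L) us) (vs∈L : All (_∈ L) vs) (ws∈L : All (_∈ L) ws) →
  Listᵁ.Unique (range us) → SameLength vs us → SameLength ws us →
  Pointwise (λ x y → v (proj₂ x) ≡ flips (ifGates p∈L new vs∈L ws∈L) v (proj₂ y))
            (if v (proj₂ p) then vs else ws) us
ifGates-flips {p = p} v p∈L [] [] [] _ _ _ with v (proj₂ p)
... | true  = []
... | false = []
ifGates-flips {p = p} {us = (_ , i) ∷ us} {(_ , j) ∷ _} {(_ , j′) ∷ _} v p∈L
              (u ∷ new) (v∈L ∷ vs∈L) (w∈L ∷ ws∈L) (i∉ ∷ un) (_ ∷ ss) (_ ∷ ts) =
  choose (v (proj₂ p)) head
    (pointwise-map-∈ (λ {x} {y} _ → skip-head {x} {y}) (ifGates-flips v p∈L new vs∈L ws∈L un ss ts))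
  where
  Gs′ = ifGates p∈L new vs∈L ws∈L
  G₁ = cnotNew u ((true , _ , p∈L) ∷ (true , _ , v∈L) ∷ [])
  G₂ = cnotNew u ((false , _ , p∈L) ∷ (true , _ , w∈L) ∷ [])
  Flips : Binding → Binding → Set
  Flips x y = v (proj₂ x) ≡ flips (G₁ ∷ G₂ ∷ Gs′) v (proj₂ y)
  skip-head : ∀ {x y} → y ∈ us → v (proj₂ x) ≡ flips Gs′ v (proj₂ y) → Flips x y
  skip-head y∈ h = trans h (sym (trans (flips-≢ v G₁ (G₂ ∷ Gs′) y≢) (flips-≢ v G₂ Gs′ y≢)))
    where y≢ = All.lookup i∉ (∈-map⁺ proj₂ y∈) ∘ sym
  -- The gates of the remaining leaves target wires other than `i`, so they contribute `false`.
  head : (if v (proj₂ p) then v j else v j′) ≡ flips (G₁ ∷ G₂ ∷ Gs′) v i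
  head rewrite ≡ᵇ-refl i
             | flips-∉ v (ifGates-acts new p∈L new vs∈L ws∈L (λ x → x)) (λ i∈ → All.lookup i∉ i∈ refl)
    = sym (multiplexer (v (proj₂ p)) (v j) (v j′))
  -- The condition is generalised to a variable, so that case analysis on it unfolds the choice of
  -- the list and that of its head together.
  choose : ∀ b → (if b then v j else v j′) ≡ flips (G₁ ∷ G₂ ∷ Gs′) v i →
           ∀ {vs ws} → Pointwise Flips (if b then vs else ws) us →
           Pointwise Flips (if b then (_ , j) ∷ vs else (_ , j′) ∷ ws) ((_ , i) ∷ us)
  choose true  h hs = h ∷ hs
  choose false h hs = h ∷ hs

-- The invariant of the abstract machine

-- One run of the machine serves all inputs, but the simulated reduction depends on them; hence the
-- family `X` of starting terms, which stays fixed along the run.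
record Invariant {n} (X : Vec Bool n → Term 0) (A : Type) (s : Machine n) : Set where
  constructor invariant
  open Machine s
  field
    unique    : Listᵁ.Unique (domain linking)
    typed     : domain linking ∣ [] ⊩ term ∶ A
    simulated : ∀ u → X u ⟶*⊒ readback s u

private variable
  X : Vec Bool n → Term 0

invariant-pure : (E : Context 0 l) {R R′ : Term l} → R ↦ R′ →
                 Invariant X A (machine (E ⟦ R ⟧) C L) → Invariant X A (machine (E ⟦ R′ ⟧) C L)
invariant-pure {X = X} {C = C} {L = L} E {R} {R′} r (invariant un d sim) =
  invariant un (plug dec (λ x → x) (⊩-↦ r (hole dec))) sim′
  where
  dec = decompose E d
  sim′ : ∀ u → X u ⟶*⊒ close L (final u C) (E ⟦ R′ ⟧)
  sim′ u = ≡.subst (X u ⟶*⊒_) (sym (close-⟦⟧ L (final u C) E R′))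
    (⊒-pure (closeᶜ L (final u C) E) (≡.subst (X u ⟶*⊒_) (close-⟦⟧ L (final u C) E R) (sim u)) (↦-subst r))

invariant-err : (E : Context 0 l) {R : Term l} →
                Invariant X A (machine (E ⟦ R ⟧) C L) → Invariant X A (machine (E ⟦ Err ⟧) C L)
invariant-err {X = X} {C = C} {L = L} E {R} (invariant un d sim) =
  invariant un (plug (decompose E d) (λ x → x) Err) sim′
  where
  sim′ : ∀ u → X u ⟶*⊒ close L (final u C) (E ⟦ Err ⟧)
  sim′ u = ≡.subst (X u ⟶*⊒_) (sym (close-⟦⟧ L (final u C) E Err))
    (⊒-err (closeᶜ L (final u C) E) (≡.subst (X u ⟶*⊒_) (close-⟦⟧ L (final u C) E R) (sim u)))

-- The common part of all rules that link new variables. The alternative `R₀ ≡ R₁` is for `tt` and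
-- `ff`, where the new variable reads back as the constant it replaces and no reduction happens.
invariant-new : (E : Context 0 l) {R : Term l} (U : Tree Binding) →
  All (Fresh n C L) (leaves U) → Listᵁ.Unique (domain (leaves U)) → All (Acts (range (leaves U))) Gs →
  (∀ {Γ B} → domain L ∣ Γ ⊩ R ∶ B → domain (leaves U ++ L) ∣ Γ ⊩ ⌜ U ⌝ ∶ B) →
  (∀ u → Listᵁ.Unique (domain L) →
    let R₀ = close L (final u C) R ; R₁ = close (leaves U ++ L) (final u (Gs ++ C)) ⌜ U ⌝ in
    R₀ ≡ R₁ ⊎ R₀ ↦ᵇ R₁) →
  Invariant {n} X A (machine (E ⟦ R ⟧) C L) →
  Invariant X A (machine (E ⟦ ⌜ U ⌝ ⟧) (Gs ++ C) (leaves U ++ L))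
invariant-new {n = n} {C = C} {L = L} {Gs = Gs} {X = X} E {R} U new unU as type step (invariant un d sim) =
  invariant (unique-++ new unU un) (plug dec (domain-++ʳ (leaves U)) (type (hole dec))) sim′
  where
  dec = decompose E d
  L′ = leaves U ++ L
  sim′ : ∀ u → X u ⟶*⊒ close L′ (final u (Gs ++ C)) (E ⟦ ⌜ U ⌝ ⟧)
  sim′ u =
    ≡.subst (X u ⟶*⊒_) (sym (trans (close-⟦⟧ L′ v′ E ⌜ U ⌝) (cong (_⟦ R₁ ⟧) (sym E≡)))) (go (step u un))
    where
    v  = final u C
    v′ = final u (Gs ++ C)
    R₁ = close L′ v′ ⌜ U ⌝
    -- The context mentions old names only, so its readback is unchanged and the whole effect is
    -- confined to the hole.
    E≡ : closeᶜ L v E ≡ closeᶜ L′ v′ E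
    E≡ = agreeᶜ dec (agree-++ u new as un)
    simE : X u ⟶*⊒ closeᶜ L v E ⟦ close L v R ⟧
    simE = ≡.subst (X u ⟶*⊒_) (close-⟦⟧ L v E R) (sim u)
    go : close L v R ≡ R₁ ⊎ close L v R ↦ᵇ R₁ → X u ⟶*⊒ closeᶜ L v E ⟦ R₁ ⟧
    go (inj₁ eq) = ≡.subst (λ R₁ → X u ⟶*⊒ closeᶜ L v E ⟦ R₁ ⟧) eq simE
    go (inj₂ r)  = ⊒-boolean (closeᶜ L v E) simE r

invariant-gate : {q : Name} {i : Wire} (E : Context 0 l) {R : Term l} → (new : Fresh n C L (q , i)) →
  All (Acts (i ∷ [])) Gs → (∀ {Γ B} → domain L ∣ Γ ⊩ R ∶ B → B ≡ bit) →
  (∀ u → Listᵁ.Unique (domain L) →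
    let R₀ = close L (final u C) R ; R₁ = bool (flips Gs (final u C) i) in R₀ ≡ R₁ ⊎ R₀ ↦ᵇ R₁) →
  Invariant {n} X A (machine (E ⟦ R ⟧) C L) →
  Invariant X A (machine (E ⟦ fvar q ⟧) (Gs ++ C) ((q , i) ∷ L))
invariant-gate {l = l} {C = C} {L = L} {Gs = Gs} {q = q} {i} E {R} new as type step =
  invariant-new E (leaf (q , i)) (new ∷ []) ([] ∷ []) as
    (λ d → ≡.subst (_ ∣ _ ⊩ _ ∶_) (sym (type d)) (fvar (here refl)))
    (λ u un → ≡.subst (λ R₁ → close L (final u C) R ≡ R₁ ⊎ close L (final u C) R ↦ᵇ R₁)
      (sym (value-new u (new ∷ []) as ([] ∷ []) un (here refl))) (step u un))

data BitTerm {k} : Term k → Set where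
  tt  : BitTerm tt
  ff  : BitTerm ff
  neg : ∀ {N} → BitTerm (app neg N)
  and : ∀ {N} → BitTerm (app and N)
  xor : ∀ {N} → BitTerm (app xor N)

-- A final `fold` or `unfold` would, by induction, identify the sum or list type of its premise with
-- `bit`.
⊩-bit : {R : Term k} → BitTerm R → Δ ∣ Γ ⊩ R ∶ A → A ≡ bit
⊩-bit r   (fold d) with () ← ⊩-bit r d
⊩-bit r   (unfold d) with () ← ⊩-bit r d
⊩-bit tt  tt          = refl
⊩-bit ff  ff          = refl
⊩-bit neg (app neg _) = refl
⊩-bit and (app and _) = refl
⊩-bit xor (app xor _) = refl

⊩-then : {P M N : Term k} → Δ ∣ Γ ⊩ ite P M N ∶ A → Δ ∣ Γ ⊩ M ∶ A
⊩-then (ite _ d _) = d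
⊩-then (fold d)    = fold (⊩-then d)
⊩-then (unfold d)  = unfold (⊩-then d)

-- As for `multiplexer`, the right sides of this and the next two identities are what `flips`
-- computes to. A control of polarity `false` negates; one of polarity `true` is cancelled by the
-- second xor.
neg-gate : (a : Bool) → not a ≡ (((a ⊻ false) ⊻ true) ∧ true) ⊻ false
neg-gate true  = refl
neg-gate false = refl

and-gate : (a b : Bool) → a ∧ b ≡ (((a ⊻ true) ⊻ true) ∧ (((b ⊻ true) ⊻ true) ∧ true)) ⊻ false
and-gate true  true  = refl
and-gate true  false = refl
and-gate false true  = refl
and-gate false false = refl

xor-gate : (a b : Bool) →
           a ⊻ b ≡ (((a ⊻ true) ⊻ true) ∧ true) ⊻ ((((b ⊻ true) ⊻ true) ∧ true) ⊻ false)
xor-gate true  true  = refl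
xor-gate true  false = refl
xor-gate false true  = refl
xor-gate false false = refl

invariant-if : {p : Name} {i : Wire} (E : Context 0 l) (V W U : Tree Binding) →
  (p∈L : (p , i) ∈ L) (V∈L : Extension L V) (W∈L : Extension L W) → SameShape V W → SameShape V U →
  (new : All (Fresh n C L) (leaves U)) → Listᵁ.Unique (domain (leaves U)) → Listᵁ.Unique (range (leaves U)) →
  Gs ↭ ifGates p∈L new V∈L W∈L →
  Invariant {n} X A (machine (E ⟦ ite (fvar p) ⌜ V ⌝ ⌜ W ⌝ ⟧) C L) →
  Invariant X A (machine (E ⟦ ⌜ U ⌝ ⟧) (Gs ++ C) (leaves U ++ L))
invariant-if {l = l} {L = L} {C = C} {Gs = Gs} {p = p} {i} E V W U p∈L V∈L W∈L VW VU new unU unR perm =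
  invariant-new E U new unU as
    (⊩-SameShape VU (All.tabulate (∈-map⁺ proj₁ ∘ ∈-++⁺ˡ)) ∘ ⊩-then)
    (λ u un → inj₂ (step u un))
  where
  as = All-resp-↭ (↭-sym perm) (ifGates-acts new p∈L new V∈L W∈L (λ x → x))
  chosen∈L : ∀ b → All (_∈ L) (if b then leaves V else leaves W)
  chosen∈L true  = V∈L
  chosen∈L false = W∈L
  step : ∀ u → Listᵁ.Unique (domain L) →
         close {l} L (final u C) (ite (fvar p) ⌜ V ⌝ ⌜ W ⌝) ↦ᵇ close (leaves U ++ L) (final u (Gs ++ C)) ⌜ U ⌝
  step u un = ≡.subst (λ P → ite P _ _ ↦ᵇ _) (sym (value-∈ un p∈L)) (choose (v i) same)
    where
    v  = final u C
    v′ = final u (Gs ++ C)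
    L′ = leaves U ++ L
    -- A leaf of the selected branch is matched with its new leaf in three moves: multiplexing by
    -- the gates in standard order, then their permutation, then reading the new wire.
    same : Pointwise (SameValue l L L′ v v′) (if v i then leaves V else leaves W) (leaves U)
    same = pointwise-map-∈
      (λ {_} {y} x∈ y∈ h →
        trans (value-∈ un (All.lookup (chosen∈L (v i)) x∈))
          (trans (cong bool (trans h (sym (flips-↭ v (proj₂ y) perm))))
                 (sym (value-new u new as unU un y∈))))
      (ifGates-flips v p∈L new V∈L W∈L unR (leaves-SameShape VU)
        (leaves-SameShape (SameShape-euclidean VW VU)))
    choose : ∀ b → Pointwise (SameValue l L L′ v v′) (if b then leaves V else leaves W) (leaves U) →
             ite (bool b) (close L v ⌜ V ⌝) (close L v ⌜ W ⌝) ↦ᵇ close L′ v′ ⌜ U ⌝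
    choose true  hs =
      ≡.subst (ite tt (close L v ⌜ V ⌝) (close L v ⌜ W ⌝) ↦ᵇ_)
              (close-SameShape l L L′ v v′ VU hs) (if-tt _ _)
    choose false hs =
      ≡.subst (ite ff (close L v ⌜ V ⌝) (close L v ⌜ W ⌝) ↦ᵇ_)
              (close-SameShape l L L′ v v′ (SameShape-euclidean VW VU) hs) (if-ff _ _)

invariant-step : {s s′ : Machine n} → s ⟶am s′ → Invariant X A s → Invariant X A s′
invariant-step (pure E r) = invariant-pure E r
invariant-step (ff E new) = invariant-gate E new [] (⊩-bit ff) (λ _ _ → inj₁ refl)
invariant-step (tt {C = C} {i₀ = i₀} E new) =
  invariant-gate E new (cnotNew-acts (new ∷ []) (here refl) new [] ∷ []) (⊩-bit tt)
    (λ u _ → inj₁ (step (final u C)))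
  where
  step : ∀ v → tt ≡ bool (flips (cnotNew new [] ∷ []) v i₀)
  step v rewrite ≡ᵇ-refl i₀ = refl
invariant-step (neg {C = C} {L} {p} {i} {i₀ = i₀} E new p∈L) =
  invariant-gate E new (cnotNew-acts (new ∷ []) (here refl) new ((false , _ , p∈L) ∷ []) ∷ []) (⊩-bit neg)
    (λ u un → inj₂ (step (final u C) un))
  where
  step : ∀ v → Listᵁ.Unique (domain L) →
         close L v (app neg (fvar p)) ↦ᵇ bool (flips (cnotNew new ((false , _ , p∈L) ∷ []) ∷ []) v i₀)
  step v un rewrite ≡ᵇ-refl i₀ | linked-∈ un p∈L | sym (neg-gate (v i)) = neg (v i)
invariant-step (and {C = C} {L} {p} {i} {p′} {i′} {i₀ = i₀} E new p∈L p′∈L) =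
  invariant-gate E new (cnotNew-acts (new ∷ []) (here refl) new ((true , _ , p∈L) ∷ (true , _ , p′∈L) ∷ []) ∷ [])
    (⊩-bit and)
    (λ u un → inj₂ (step (final u C) un))
  where
  step : ∀ v → Listᵁ.Unique (domain L) →
         close L v (app and (pair (fvar p) (fvar p′))) ↦ᵇ
         bool (flips (cnotNew new ((true , _ , p∈L) ∷ (true , _ , p′∈L) ∷ []) ∷ []) v i₀)
  step v un rewrite ≡ᵇ-refl i₀ | linked-∈ un p∈L | linked-∈ un p′∈L | sym (and-gate (v i) (v i′)) =
    and (v i) (v i′)
invariant-step (xor {C = C} {L} {p} {i} {p′} {i′} {i₀ = i₀} E new p∈L p′∈L) =
  invariant-gate E new
    (cnotNew-acts (new ∷ []) (here refl) new ((true , _ , p∈L) ∷ []) ∷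
     cnotNew-acts (new ∷ []) (here refl) new ((true , _ , p′∈L) ∷ []) ∷ []) (⊩-bit xor)
    (λ u un → inj₂ (step (final u C) un))
  where
  step : ∀ v → Listᵁ.Unique (domain L) →
         close L v (app xor (pair (fvar p) (fvar p′))) ↦ᵇ
         bool (flips (cnotNew new ((true , _ , p∈L) ∷ []) ∷ cnotNew new ((true , _ , p′∈L) ∷ []) ∷ []) v i₀)
  step v un rewrite ≡ᵇ-refl i₀ | linked-∈ un p∈L | linked-∈ un p′∈L | sym (xor-gate (v i) (v i′)) =
    xor (v i) (v i′)
invariant-step (if-same E V W U p∈L V∈L W∈L VW VU new unU unR perm) =
  invariant-if E V W U p∈L V∈L W∈L VW VU new unU unR perm
invariant-step (if-err E V W _ _ _ _) = invariant-err E

invariant-steps : {s s′ : Machine n} → s ⟶am* s′ → Invariant X A s → Invariant X A s′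
invariant-steps ε        inv = inv
invariant-steps (r ◅ rs) inv = invariant-steps rs (invariant-step r inv)

-- The initial machine

abstracted : Name → Name → Term (suc k)
abstracted x y = if x ≡ᵇ y then bvar zero else fvar y

-- With weakening and replacement fused into one substitution, `subst-subst` applies to composites
-- involving `abstractName`.
abstractName-as-subst : (x : Name) (M : Term k) →
                        abstractName x M ≡ subst (λ i → bvar (suc i)) (abstracted x) M
abstractName-as-subst x M = subst-rename (λ _ → refl) M

-- The side condition for moving a substitution past a binder of `x`: the substituted terms are free
-- of `x`, while `ν` keeps `x` itself. It is expressed through the effect of `abstractName x`, in
-- the form in which `abstractName-subst` uses it.
record Avoids (x : Name) (σ : Fin k → Term l) (ν : Name → Term l) : Set where
  constructor avoids
  field
    indices : ∀ i → abstractName x (σ i) ≡ weaken (σ i)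
    names   : ∀ y → abstractName x (ν y) ≡ (if x ≡ᵇ y then bvar zero else weaken (ν y))

abstractName-subst : {x : Name} {σ : Fin k → Term l} {ν : Name → Term l} → Avoids x σ ν → (M : Term k) →
                     abstractName x (subst σ ν M) ≡ subst (lifts σ) (weaken ∘ ν) (abstractName x M)
abstractName-subst {x = x} {σ} {ν} (avoids hσ hν) M =
  trans (abstractName-as-subst x (subst σ ν M))
    (trans (subst-subst (λ i → trans (sym (abstractName-as-subst x (σ i))) (hσ i))
                        (λ y → trans (sym (abstractName-as-subst x (ν y))) (hν y)) M)
      (sym (trans (cong (subst (lifts σ) (weaken ∘ ν)) (abstractName-as-subst x M))
                  (subst-subst (λ _ → refl) names M))))
  where
  names : ∀ y → subst (lifts σ) (weaken ∘ ν) (abstracted x y) ≡ (if x ≡ᵇ y then bvar zero else weaken (ν y))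
  names y with x ≡ᵇ y
  ... | true  = refl
  ... | false = refl

subst-letsIn : {xs : Vec Name n} {σ : Fin k → Term l} {ν : Name → Term l} →
               Vecᴬ.All (λ x → Avoids x σ ν) xs → (Ns : Vec (Term k) n) (M : Term k) →
               subst σ ν (letsIn xs Ns M) ≡ letsIn xs (map (subst σ ν) Ns) (subst σ ν M)
subst-letsIn []       []       M = refl
subst-letsIn {xs = x ∷ xs} (a ∷ as) (N ∷ Ns) M =
  cong (λ Q → app (lam Q) _)
    (trans (sym (abstractName-subst a (letsIn xs Ns M))) (cong (abstractName x) (subst-letsIn as Ns M)))

_≔_ : Name → Bool → Name → Term k
(x ≔ b) y = if x ≡ᵇ y then bool b else fvar y

assign : Vec Name n → Vec Bool n → Name → Term k
assign []       []      y = fvar y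
assign (x ∷ xs) (b ∷ u) y = if x ≡ᵇ y then bool b else assign xs u y

abstractName-[] : (x : Name) (b : Bool) (M : Term k) → abstractName x M [ bool b ] ≡ substNames (x ≔ b) M
abstractName-[] x b M =
  trans (cong (_[ bool b ]) (abstractName-as-subst x M)) (subst-subst (λ _ → refl) names M)
  where
  names : ∀ y → abstracted x y [ bool b ] ≡ (x ≔ b) y
  names y with x ≡ᵇ y
  ... | true  = refl
  ... | false = refl

abstractName-bool : (x : Name) (b : Bool) → abstractName {k} x (bool b) ≡ weaken (bool b)
abstractName-bool x true  = refl
abstractName-bool x false = refl

≔-avoids : {x y : Name} {b : Bool} → y ≢ x → Avoids {k} y bvar (x ≔ b)
≔-avoids {x = x} {y} {b} y≢x = avoids (λ _ → refl) names
  where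
  names : ∀ z → abstractName y ((x ≔ b) z) ≡ (if y ≡ᵇ z then bvar zero else weaken ((x ≔ b) z))
  names z with x ≟ z
  ... | yes refl rewrite ≡ᵇ-refl x | ≢⇒≡ᵇ y≢x = abstractName-bool y b
  ... | no x≢z   rewrite ≢⇒≡ᵇ x≢z = refl

-- A boolean contains no names, so once it has replaced `x`, the remaining assignment cannot act on
-- it.
assign-∷ : (x : Name) (xs : Vec Name n) (b : Bool) (u : Vec Bool n) (M : Term k) →
           substNames (assign xs u) (substNames (x ≔ b) M) ≡ substNames (assign (x ∷ xs) (b ∷ u)) M
assign-∷ {k = k} x xs b u = subst-subst (λ _ → refl) names
  where
  names : ∀ y → substNames {k} (assign xs u) ((x ≔ b) y) ≡ assign (x ∷ xs) (b ∷ u) y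
  names y with x ≡ᵇ y
  ... | true  = subst-bool bvar (assign xs u) b
  ... | false = refl

⟶-appʳ : {M N N′ : Term k} → N ⟶ N′ → app M N ⟶ app M N′
⟶-appʳ (pure E r)    = pure (appʳ _ E) r
⟶-appʳ (boolean E r) = boolean (appʳ _ E) r

⟶-π₁ : {M M′ : Term k} → M ⟶ M′ → π₁ M ⟶ π₁ M′
⟶-π₁ (pure E r)    = pure (π₁ E) r
⟶-π₁ (boolean E r) = boolean (π₁ E) r

⟶-π₂ : {M M′ : Term k} → M ⟶ M′ → π₂ M ⟶ π₂ M′
⟶-π₂ (pure E r)    = pure (π₂ E) r
⟶-π₂ (boolean E r) = boolean (π₂ E) r

-- Each bound term is brought to its boolean before its β-step. The resulting substitution then
-- passes the later binders because the names are distinct, and leaves the later bound terms alone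
-- by `closed`.
letsIn-⟶* : {xs : Vec Name n} {Ns : Vec (Term k) n} {u : Vec Bool n} → Unique xs →
            (∀ ν → map (substNames ν) Ns ≡ Ns) → Vecᴾ.Pointwise _⟶*_ Ns (map bool u) →
            (M : Term k) → letsIn xs Ns M ⟶* substNames (assign xs u) M
letsIn-⟶* {xs = []} {[]} {[]} [] closed [] M =
  ≡.subst (M ⟶*_) (sym (subst-id (λ _ → refl) (λ _ → refl) M)) ε
letsIn-⟶* {xs = x ∷ xs} {N ∷ Ns} {b ∷ u} (x∉ ∷ un) closed (r ∷ rs) M =
  gmap (app _) ⟶-appʳ r ◅◅ pure □ (β _ _) ◅
  ≡.subst (_⟶* _) (sym head)
    (≡.subst (_ ⟶*_) (assign-∷ x xs b u M)
      (letsIn-⟶* un (∷-injectiveʳ ∘ closed) rs (substNames (x ≔ b) M)))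
  where
  head : abstractName x (letsIn xs Ns M) [ bool b ] ≡ letsIn xs Ns (substNames (x ≔ b) M)
  head = trans (abstractName-[] x b (letsIn xs Ns M))
    (trans (subst-letsIn (Vecᴬ.map (λ x≢y → ≔-avoids (x≢y ∘ sym)) x∉) Ns M)
           (cong (λ Ns → letsIn xs Ns (substNames (x ≔ b) M)) (∷-injectiveʳ (closed (x ≔ b)))))

subst-projections : (σ : Fin k → Term l) (ν : Name → Term l) (n : ℕ) (P : Term k) →
                    map (subst σ ν) (projections n P) ≡ projections n (subst σ ν P)
subst-projections σ ν zero          P = refl
subst-projections σ ν (suc zero)    P = refl
subst-projections σ ν (suc (suc n)) P = cong (π₁ (subst σ ν P) ∷_) (subst-projections σ ν (suc n) (π₂ P))

projections-⟶* : (u : Vec Bool n) {P : Term k} → P ⟶* tuple (map bool u) →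
                 Vecᴾ.Pointwise _⟶*_ (projections n P) (map bool u)
projections-⟶* []          rs = []
projections-⟶* (b ∷ [])    rs = rs ∷ []
projections-⟶* (b ∷ a ∷ u) rs =
  (gmap π₁ ⟶-π₁ rs ◅◅ pure □ (π₁ _ _) ◅ ε) ∷
  projections-⟶* (a ∷ u) (gmap π₂ ⟶-π₂ rs ◅◅ pure □ (π₂ _ _) ◅ ε)

subst-tuple : (σ : Fin k → Term l) (ν : Name → Term l) (u : Vec Bool n) →
              subst σ ν (tuple (map bool u)) ≡ tuple (map bool u)
subst-tuple σ ν []          = refl
subst-tuple σ ν (b ∷ [])    = subst-bool σ ν b
subst-tuple σ ν (b ∷ a ∷ u) = cong₂ pair (subst-bool σ ν b) (subst-tuple σ ν (a ∷ u))

rename-tuple : (ρ : Fin k → Fin l) (u : Vec Bool n) → rename ρ (tuple (map bool u)) ≡ tuple (map bool u)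
rename-tuple ρ []          = refl
rename-tuple ρ (b ∷ [])    = rename-bool ρ b
rename-tuple ρ (b ∷ a ∷ u) = cong₂ pair (rename-bool ρ b) (rename-tuple ρ (a ∷ u))

letTuple-⟶* : {xs : Vec Name n} → Unique xs → (u : Vec Bool n) (M : Term 0) →
              letTuple xs (tuple (map bool u)) M ⟶* substNames (assign xs u) M
letTuple-⟶* {n} {xs} un u M =
  pure □ (β _ _) ◅ ≡.subst (_⟶* substNames (assign xs u) M) (sym head)
    (letsIn-⟶* un closed (projections-⟶* u ε) M)
  where
  N : Term 0
  N = tuple (map bool u)
  closed : ∀ ν → map (substNames ν) (projections n N) ≡ projections n N
  closed ν = trans (subst-projections bvar ν n N) (cong (projections n) (subst-tuple bvar ν u))
  single-avoids : ∀ x → Avoids x (single N) fvar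
  single-avoids x = avoids indices (λ _ → refl)
    where
    indices : ∀ i → abstractName x (single N i) ≡ weaken (single N i)
    indices zero = trans (abstractName-as-subst x N) (trans (subst-tuple _ _ u) (sym (rename-tuple suc u)))
  head : letsIn xs (projections n (bvar zero)) (weaken M) [ N ] ≡ letsIn xs (projections n N) M
  head = trans (subst-letsIn (Vecᴬ.universal single-avoids xs) (projections n (bvar zero)) (weaken M))
    (cong₂ (letsIn xs) (subst-projections (single N) fvar n (bvar zero)) (weaken-[] M N))

≡ᵇ-sym : (x y : ℕ) → (x ≡ᵇ y) ≡ (y ≡ᵇ x)
≡ᵇ-sym zero    zero    = refl
≡ᵇ-sym zero    (suc y) = refl
≡ᵇ-sym (suc x) zero    = refl
≡ᵇ-sym (suc x) (suc y) = ≡ᵇ-sym x y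

links : Vec Name n → Vec Wire n → Linking
links xs I = Vec.toList (Vec.zip xs I)

initial-cong : {i : Wire} {I : Vec Wire n} {b : Bool} {u : Vec Bool n} → Vecᴬ.All (i ≢_) I →
               (xs : Vec Name n) (y : Name) →
               value {k} (links xs I) (initial (i ∷ I) (b ∷ u)) y ≡ value (links xs I) (initial I u) y
initial-cong {i = i} {I} {b} {u} i∉ xs y = go i∉ xs
  where
  -- The recursion shortens the linked wires `J` but must keep the valuation on the full `I`.
  go : ∀ {n} {J : Vec Wire n} → Vecᴬ.All (i ≢_) J → (xs : Vec Name n) →
       value (links xs J) (initial (i ∷ I) (b ∷ u)) y ≡ value (links xs J) (initial I u) y
  go []          []       = refl
  go (i≢ ∷ i∉) (x ∷ xs) with y ≡ᵇ x
  ... | true  rewrite ≢⇒≡ᵇ (i≢ ∘ sym) = refl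
  ... | false = go i∉ xs

-- The left side looks up a wire and then its bit, the right side looks up the bit directly. With
-- distinct wires, no earlier input overrides the bit found.
value-initial : {I : Vec Wire n} → Unique I → (xs : Vec Name n) (u : Vec Bool n) (y : Name) →
                value {k} (links xs I) (initial I u) y ≡ assign xs u y
value-initial []       []       []      y = refl
value-initial {I = i ∷ I} (i∉ ∷ un) (x ∷ xs) (b ∷ u) y rewrite ≡ᵇ-sym x y with y ≡ᵇ x
... | true  rewrite ≡ᵇ-refl i = refl
... | false = trans (initial-cong i∉ xs y) (value-initial un xs u y)

inputs-unique : (n : ℕ) → Unique (inputs n)
inputs-unique n = Vecᵁ.tabulate⁺ (toℕ-injective ∘ suc-injective)

letTuple-EmptyAM : {xs : Vec Name n} → Unique xs → (u : Vec Bool n) (M : Term 0) →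
                   letTuple xs (tuple (map bool u)) M ⟶* readback (EmptyAM xs M) u
letTuple-EmptyAM {n} {xs} un u M = ≡.subst (letTuple xs (tuple (map bool u)) M ⟶*_)
  (subst-cong (λ _ → refl) (λ y → sym (value-initial (inputs-unique n) xs u y)) M) (letTuple-⟶* un u M)

domain-links : (xs : Vec Name n) (I : Vec Wire n) → domain (links xs I) ≡ Vec.toList xs
domain-links []       []      = refl
domain-links (x ∷ xs) (i ∷ I) = cong (x ∷_) (domain-links xs I)

toList-unique : {xs : Vec Name n} → Unique xs → Listᵁ.Unique (Vec.toList xs)
toList-unique []        = []
toList-unique (x∉ ∷ un) = Vecᴬ.toList⁺ x∉ ∷ toList-unique un

∈-bits : (xs : Vec Name n) {x : Name} {B : Type} → (x , B) ∈ bits xs → x ∈ Vec.toList xs × B ≡ bit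
∈-bits (x ∷ xs) (here refl) = here refl , refl
∈-bits (x ∷ xs) (there x∈) with x∈xs , e ← ∈-bits xs x∈ = there x∈xs , e

invariant-EmptyAM : {xs : Vec Name n} {M : Term 0} → Unique xs → bits xs ∣ [] ⊢ M ∶ A →
                    Invariant (readback (EmptyAM xs M)) A (EmptyAM xs M)
invariant-EmptyAM {n} {xs = xs} un d = invariant
  (≡.subst Listᵁ.Unique (sym (domain-links xs (inputs n))) (toList-unique un))
  (≡.subst (_∣ [] ⊩ _ ∶ _) (sym (domain-links xs (inputs n))) (⊢⇒⊩ (∈-bits xs) d))
  (λ u → _ , ε , ⇛-refl)

-- Final machines

⊩-fvar : {x : Name} → Δ ∣ Γ ⊩ fvar x ∶ A → x ∈ Δ × A ≡ bit
⊩-fvar (fvar x∈Δ) = x∈Δ , refl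
⊩-fvar (fold d) with () ← proj₂ (⊩-fvar d)
⊩-fvar (unfold d) with () ← proj₂ (⊩-fvar d)

-- No `bit^ m` is a sum or a list, so these derivations cannot end in `fold` or `unfold`, and the
-- three forms `skip`, name and pair can only have the types 𝟙, `bit` and a product respectively.
⊩-tuple-size : (m : ℕ) (ps : Vec Name k) → Δ ∣ [] ⊩ tuple (map fvar ps) ∶ bit^ m → k ≡ m
⊩-tuple-size zero          []           d          = refl
⊩-tuple-size zero          (p ∷ [])     ()
⊩-tuple-size zero          (p ∷ q ∷ ps) ()
⊩-tuple-size (suc zero)    []           ()
⊩-tuple-size (suc zero)    (p ∷ [])     d          = refl
⊩-tuple-size (suc zero)    (p ∷ q ∷ ps) ()
⊩-tuple-size (suc (suc m)) []           ()
⊩-tuple-size (suc (suc m)) (p ∷ [])     ()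
⊩-tuple-size (suc (suc m)) (p ∷ q ∷ ps) (pair _ d) = cong suc (⊩-tuple-size (suc m) (q ∷ ps) d)

value-∈-domain : (v : Valuation) {x : Name} → Listᵁ.Unique (domain L) → x ∈ domain L →
                 ∃ λ b → value {k} L v x ≡ bool b
value-∈-domain v un x∈L with (_ , i) , p∈L , refl ← ∈-map⁻ proj₁ x∈L = v i , value-∈ un p∈L

-- Typing puts every component in the domain of the linking, where each name reads back as a
-- boolean.
close-tuple : (v : Valuation) → Listᵁ.Unique (domain L) → (m : ℕ) (ps : Vec Name m) →
              domain L ∣ [] ⊩ tuple (map fvar ps) ∶ bit^ m →
              ∃ λ (c : Vec Bool m) → close {0} L v (tuple (map fvar ps)) ≡ tuple (map bool c)
close-tuple v un zero          []           d = [] , refl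
close-tuple v un (suc zero)    (p ∷ [])     d
  with b , e ← value-∈-domain v un (proj₁ (⊩-fvar d)) = b ∷ [] , e
close-tuple v un (suc (suc m)) (p ∷ q ∷ ps) (pair d e)
  with b , eq ← value-∈-domain v un (proj₁ (⊩-fvar d)) | a ∷ c , eqs ← close-tuple v un (suc m) (q ∷ ps) e =
  b ∷ a ∷ c , cong₂ pair eq eqs

close-tuple-⇔ : {M : Term 0} (v : Valuation) → Listᵁ.Unique (domain L) → (m : ℕ) (ps : Vec Name m) →
  domain L ∣ [] ⊩ tuple (map fvar ps) ∶ bit^ m → M ⟶*⊒ close L v (tuple (map fvar ps)) →
  (c : Vec Bool m) → (close L v (tuple (map fvar ps)) ≡ tuple (map bool c)) ⇔ (M ⟶* tuple (map bool c))
close-tuple-⇔ {M = M} v un m ps typed (T , rs , d) c with a , e ← close-tuple v un m ps typed =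
  mk⇔ (λ e′ → ≡.subst (M ⟶*_) (trans (sym e) e′) M⟶a)
      -- `M` reaches both the tuple of `a` and that of `c`, so confluence identifies them.
      (λ rs′ → trans e (⟶*-tuple-unique a c M⟶a rs′))
  where
  M⟶a : M ⟶* tuple (map bool a)
  M⟶a = ≡.subst (M ⟶*_) (tuple-unerase a (⇛-target e d)) rs

theorem4 : (n m k : ℕ) (xs : Vec Name n) → Unique xs →
    (M : Term 0) → bits xs ∣ [] ⊢ M ∶ bit^ m →
    (ps : Vec Name k) (C : List Gate) (L : Linking) →
    EmptyAM xs M ⟶am* machine (tuple (map fvar ps)) C L →
    k ≡ m ×
    ((u : Vec Bool n) (c : Vec Bool m) →
    (readback (machine (tuple (map fvar ps)) C L) u ≡ tuple (map bool c)) ⇔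
    (letTuple xs (tuple (map bool u)) M ⟶* tuple (map bool c)))
theorem4 n m k xs un M ⊢M ps C L steps
  with invariant unL typed simulated ← invariant-steps steps (invariant-EmptyAM un ⊢M)
  with refl ← ⊩-tuple-size m ps typed =
  refl , λ u → let _ , rs , d = simulated u in
    -- The simulation starts at the readback of the initial machine; the reduction of the `let` to
    -- that term is put in front.
    close-tuple-⇔ (final u C) unL m ps typed (_ , letTuple-EmptyAM un u M ◅◅ rs , d)
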